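{- Every planar graph $G$ admits a maximum matching $M$ such that either $M$ is perfect, or every vertex unmatched by $M$ has degree at most $5$ in $G$.
   Context: Graphs are finite and simple. A vertex is unmatched by $M$ if it is incident to no edge of $M$; a matching is perfect if there is no unmatched vertex. A maximum matching is one of maximum cardinality. -}

module Defs where

open import Data.Bool.Base using (Bool; T)
open import Data.Bool.Properties using (T?)
open import Data.Fin.Base using (Fin)
open import Data.Fin.Properties using (_<?_)
open import Data.List.Base using (List; length; filter; allFin; cartesianProduct)
open import Data.Nat.Base using (ℕ; _+_; _*_; _≤_)
open import Data.Product.Base using (Σ; ∃; _×_; _,_)
open import Data.Sum.Base using (_⊎_)
open import Function.Base using (_∘_)
open import Function.Bundles using (Bijection; Inverse; _↔_)
open import Level using (0ℓ)
open import Relation.Binary.Core using (Rel)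
import Relation.Binary.Construct.Closure.Equivalence as Equivalence
open import Relation.Binary.PropositionalEquality.Core using (_≡_)
import Relation.Binary.PropositionalEquality.Properties as ≡
open import Relation.Nullary.Decidable.Core using (_×-dec_)
open import Relation.Nullary.Negation.Core using (¬_)

------------------------------------------------------------------------
-- Finite simple graphs

record Graph (n : ℕ) : Set where
  field
    adj    : Fin n → Fin n → Bool
    sym    : ∀ {u v} → T (adj u v) → T (adj v u)
    irrefl : ∀ {v} → ¬ T (adj v v)

  Adj : Rel (Fin n) 0ℓ
  Adj u v = T (adj u v)

open Graph public using (Adj)

module _ {n : ℕ} (G : Graph n) where

  open Graph G using (adj)

  degree : Fin n → ℕ
  degree v = length (filter (λ w → T? (adj v w)) (allFin n))

  -- Each edge is listed once, with its smaller endpoint first.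
  edges : List (Fin n × Fin n)
  edges = filter (λ (u , v) → (u <? v) ×-dec T? (adj u v))
                 (cartesianProduct (allFin n) (allFin n))

------------------------------------------------------------------------
-- Matchings
--
-- A set of edges of G is represented by the spanning subgraph of G having
-- exactly those edges.

module _ {n : ℕ} where

  IsMatching : Graph n → Graph n → Set
  IsMatching G M =
    (∀ {u v} → Adj M u v → Adj G u v) ×
    (∀ {u v w} → Adj M u v → Adj M u w → v ≡ w)

  IsMaximumMatching : Graph n → Graph n → Set
  IsMaximumMatching G M =
    IsMatching G M ×
    (∀ M′ → IsMatching G M′ → length (edges M′) ≤ length (edges M))

  Unmatched : Graph n → Fin n → Set
  Unmatched M v = ∀ w → ¬ Adj M v w

  Perfect : Graph n → Set
  Perfect M = ∀ v → ¬ Unmatched M v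

------------------------------------------------------------------------
-- Planarity
--
-- The library has neither real numbers nor topology, so drawings in the
-- plane (equivalently, on the sphere) are given combinatorially: a cellular
-- embedding of a connected graph in an oriented closed surface is, up to
-- homeomorphism, a rotation system, that is, a cyclic order of the edges
-- around each vertex. The surface is the sphere when its genus is 0.

-- The equivalence relation generated by R has exactly k classes.
HasClasses : {A : Set} → Rel A 0ℓ → ℕ → Set
HasClasses R k = Bijection (Equivalence.setoid R) (≡.setoid (Fin k))

-- The classes of the equivalence relation generated by Step f are the
-- orbits of f when f is a permutation.
Step : {A : Set} → (A → A) → Rel A 0ℓ
Step f x y = f x ≡ y

module _ {n : ℕ} (G : Graph n) where

  -- An edge together with one of its two directions.
  record Dart : Set where
    constructor dart
    field
      tail head : Fin n
      joined    : Adj G tail head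

  open Dart public

  reverse : Dart → Dart
  reverse (dart u v uv) = dart v u (Graph.sym G uv)

  -- A permutation of the darts whose orbits are the sets of all darts
  -- leaving a given vertex: next d follows d in the cyclic order at tail d.
  record RotationSystem : Set where
    field
      rotation   : Dart ↔ Dart

    next : Dart → Dart
    next = Inverse.to rotation

    field
      tail-next  : ∀ d → tail (next d) ≡ tail d
      transitive : ∀ d e → tail d ≡ tail e →
                   Equivalence.EqClosure (Step next) d e

    -- Arrive along d, then leave along the dart after reverse d:
    -- the orbits are the facial walks.
    faceStep : Dart → Dart
    faceStep = next ∘ reverse

  -- Vertices, edges, faces and components are counted as classes of darts,
  -- so isolated vertices, which do not affect planarity, contribute nothing.
  -- Every component is given its own surface, and
  -- V − E + F = 2C − 2g, where g is the sum of the genera of these surfaces;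
  -- the equation below therefore says that all of them are spheres.
  GenusZero : RotationSystem → Set
  GenusZero ρ =
    ∃ λ V → ∃ λ E → ∃ λ F → ∃ λ C →
      HasClasses (Step next) V ×
      HasClasses (Step reverse) E ×
      HasClasses (Step faceStep) F ×
      HasClasses (λ d e → Step next d e ⊎ Step reverse d e) C ×
      V + F ≡ E + 2 * C
    where open RotationSystem ρ

  Planar : Set
  Planar = Σ RotationSystem GenusZero

{-# OPTIONS --safe #-}
-- Call a vertex high if its degree is at least 6. Among the vertex sets of maximum matchings, take
-- one, S, with the most high vertices, and suppose that it misses a high vertex v. Let D be the set
-- of those x for which some maximum matching covers exactly S + v − x; by the choice of S all of D is
-- high. As in the Gallai–Edmonds theorem, removing the set ∂D of outer neighbours of D from S + v
-- lowers the size of a largest matching by one for each vertex, so that a largest matching in the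
-- rest misses more than |∂D| vertices, all of them in D. By Gallai's lemma these lie in different
-- components of G[D].
--
-- Euler's formula bounds the number of darts of a subgraph on p vertices with at least q components
-- by 6p − 6q. For G[D] and for the graph of all edges that touch D this gives at most 6|D| − 6q and
-- 6(|D| + |∂D|) darts, where q > |∂D|. But the two numbers add up to twice the sum of the degrees
-- in D, which is at least 12|D|: a contradiction.
--
-- Euler's formula passes to subgraphs by the duality of primal and dual ranks: no edge can join two
-- components of the graph of some of the other edges and, at the same time, two faces that are still
-- separate after the remaining edges have been deleted.
module Submission where

open import Defs hiding (tail; head; joined; reverse)
open import Data.Bool.Base using (Bool; true; false; T; not; _∧_; _∨_; _xor_; if_then_else_)
open import Data.Bool.Properties
  using (T?; T-irrelevant; not-injective; ∧-comm; ∧-conicalˡ; ∧-conicalʳ; ∨-comm)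
  renaming (_≟_ to _≟ᵇ_)
import Data.Bool.Solver as Bool
open import Data.Fin.Base using (Fin) renaming (_<_ to _<ᶠ_)
open import Data.Fin.Properties using (_≟_; any?; all?; _<?_; <-cmp) renaming (<-asym to <ᶠ-asym)
open import Data.Fin.Subset.Properties using (anySubset?)
open import Data.List.Base
  using (List; []; _∷_; _++_; _ʳ++_; map; length; filter; allFin; cartesianProduct)
open import Data.List.Membership.Propositional using (_∈_; find; lose)
open import Data.List.Membership.Propositional.Properties
  using (∈-∃++; ∈-++⁺ˡ; ∈-++⁺ʳ; ∈-++⁻; ∈-filter⁺; ∈-filter⁻; ∈-map⁺; ∈-map⁻; ∈-allFin; ∈-cartesianProduct⁺)
open import Data.List.Membership.Propositional.Properties.WithK using (unique∧set⇒bag)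
import Data.List.Properties as List
open import Data.List.Relation.Binary.BagAndSetEquality using (∼bag⇒↭)
open import Data.List.Relation.Binary.Permutation.Propositional as ↭ using (_↭_)
open import Data.List.Relation.Unary.All as All using (All; []; _∷_)
import Data.List.Relation.Unary.All.Properties as All
open import Data.List.Relation.Unary.AllPairs as AllPairs using (AllPairs; []; _∷_)
import Data.List.Relation.Unary.AllPairs.Properties as AllPairs
open import Data.List.Relation.Unary.Any as Any using (here; there)
open import Data.List.Relation.Unary.Unique.Propositional using (Unique)
import Data.List.Relation.Unary.Unique.Propositional.Properties as Unique
open import Data.Nat.Base using (ℕ; zero; suc; _+_; _*_; _≤_; _<_; z≤n; s≤s; s≤s⁻¹)
open import Data.Nat.Properties as ℕ hiding (_≟_; _<?_; <-cmp)
open import Algebra.Properties.CommutativeSemigroup +-commutativeSemigroup using (x∙yz≈y∙xz; xy∙z≈xz∙y)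
open import Data.Nat.Solver using (module +-*-Solver)
open import Data.Product.Base using (Σ; ∃; _×_; _,_; proj₁; proj₂)
open import Data.Sum.Base using (_⊎_; inj₁; inj₂; [_,_])
open import Data.Unit.Base using (⊤)
open import Data.Vec.Base using (lookup; tabulate)
open import Data.Vec.Properties using (lookup∘tabulate)
open import Function.Base using (_∘_; id)
open import Function.Bundles using (Inverse; Bijection; mk⇔)
open import Level using (0ℓ)
open import Relation.Binary.Core using (Rel)
import Relation.Binary.Construct.Closure.Equivalence as Equivalence
open import Relation.Binary.Construct.Closure.ReflexiveTransitive using (ε; _◅_)
open import Relation.Binary.Construct.Closure.Symmetric using (fwd; bwd)
import Relation.Binary.Construct.On as On
open import Relation.Binary.Definitions using (tri<; tri≈; tri>)
open import Relation.Binary.PropositionalEquality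
  using (_≡_; _≢_; _≗_; refl; cong; cong₂; sym; trans; subst; module ≡-Reasoning)
import Relation.Binary.PropositionalEquality.Properties as ≡
open import Relation.Binary.Structures using (IsEquivalence)
open import Relation.Nullary.Decidable
  using (Dec; yes; no; does; ¬?; _×-dec_; _⊎-dec_; dec-true; dec-false; isYes; toWitness; fromWitness)
open import Relation.Nullary.Negation.Core using (¬_; contradiction)
open import Relation.Unary using (Pred; Decidable)

private
  variable
    A A′ : Set
    n : ℕ

-- Counting

⟦_⟧ : Bool → ℕ
⟦ true ⟧  = 1
⟦ false ⟧ = 0

⟦⟧-mono : ∀ {a b} → (a ≡ true → b ≡ true) → ⟦ a ⟧ ≤ ⟦ b ⟧
⟦⟧-mono {false} f = z≤n
⟦⟧-mono {true}  f = ≤-reflexive (sym (cong ⟦_⟧ (f refl)))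

∑ : List A → (A → ℕ) → ℕ
∑ []       f = 0
∑ (x ∷ xs) f = f x + ∑ xs f

count : List A → (A → Bool) → ℕ
count xs P = ∑ xs (⟦_⟧ ∘ P)

∑-cong-∈ : ∀ (xs : List A) {f g : A → ℕ} → (∀ {x} → x ∈ xs → f x ≡ g x) → ∑ xs f ≡ ∑ xs g
∑-cong-∈ []       eq = refl
∑-cong-∈ (x ∷ xs) eq = cong₂ _+_ (eq (here refl)) (∑-cong-∈ xs (eq ∘ there))

∑-cong : ∀ (xs : List A) {f g : A → ℕ} → (∀ x → f x ≡ g x) → ∑ xs f ≡ ∑ xs g
∑-cong xs eq = ∑-cong-∈ xs λ {x} _ → eq x

∑-mono : ∀ (xs : List A) {f g : A → ℕ} → (∀ x → f x ≤ g x) → ∑ xs f ≤ ∑ xs g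
∑-mono []       le = z≤n
∑-mono (x ∷ xs) le = +-mono-≤ (le x) (∑-mono xs le)

∑-mono-< : ∀ {xs : List A} {f g : A → ℕ} {x} → (∀ x → f x ≤ g x) → x ∈ xs → f x < g x →
           ∑ xs f < ∑ xs g
∑-mono-< {xs = _ ∷ xs} le (here refl) lt = +-mono-<-≤ lt (∑-mono xs le)
∑-mono-< {xs = y ∷ xs} le (there x∈)  lt = +-mono-≤-< (le y) (∑-mono-< le x∈ lt)

∑-+ : ∀ (xs : List A) (f g : A → ℕ) → ∑ xs (λ x → f x + g x) ≡ ∑ xs f + ∑ xs g
∑-+ []       f g = refl
∑-+ (x ∷ xs) f g rewrite ∑-+ xs f g =
  solve 4 (λ a b c d → (a :+ b) :+ (c :+ d) := (a :+ c) :+ (b :+ d)) refl (f x) (g x) (∑ xs f) (∑ xs g)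
  where open +-*-Solver

∑-*ˡ : ∀ (xs : List A) k (f : A → ℕ) → ∑ xs (λ x → k * f x) ≡ k * ∑ xs f
∑-*ˡ []       k f = sym (*-zeroʳ k)
∑-*ˡ (x ∷ xs) k f rewrite ∑-*ˡ xs k f = sym (*-distribˡ-+ k (f x) (∑ xs f))

∑-zero : ∀ (xs : List A) → ∑ xs (λ _ → 0) ≡ 0
∑-zero []       = refl
∑-zero (x ∷ xs) = ∑-zero xs

∑-swap : ∀ (xs : List A) (ys : List A′) (f : A → A′ → ℕ) →
         ∑ xs (λ x → ∑ ys (f x)) ≡ ∑ ys (λ y → ∑ xs (λ x → f x y))
∑-swap []       ys f = sym (∑-zero ys)
∑-swap (x ∷ xs) ys f rewrite ∑-swap xs ys f = sym (∑-+ ys (f x) (λ y → ∑ xs (λ x → f x y)))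

∑-++ : ∀ (xs ys : List A) (f : A → ℕ) → ∑ (xs ++ ys) f ≡ ∑ xs f + ∑ ys f
∑-++ []       ys f = refl
∑-++ (x ∷ xs) ys f rewrite ∑-++ xs ys f = sym (+-assoc (f x) (∑ xs f) (∑ ys f))

∑-map : ∀ (g : A → A′) xs (f : A′ → ℕ) → ∑ (map g xs) f ≡ ∑ xs (f ∘ g)
∑-map g []       f = refl
∑-map g (x ∷ xs) f = cong (f (g x) +_) (∑-map g xs f)

∑-↭ : ∀ {xs ys : List A} (f : A → ℕ) → xs ↭ ys → ∑ xs f ≡ ∑ ys f
∑-↭ f ↭.refl         = refl
∑-↭ f (↭.prep x p)    = cong (f x +_) (∑-↭ f p)
∑-↭ f (↭.swap {ys = ys} x y p) rewrite ∑-↭ f p =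
  solve 3 (λ a b c → a :+ (b :+ c) := b :+ (a :+ c)) refl (f x) (f y) (∑ ys f)
  where open +-*-Solver
∑-↭ f (↭.trans p q)   = trans (∑-↭ f p) (∑-↭ f q)

-- Both sides are the sum over xs without x, plus f x + g x.
∑-update : ∀ {xs : List A} {x} (f g : A → ℕ) → Unique xs → x ∈ xs → (∀ {y} → y ≢ x → f y ≡ g y) →
           ∑ xs f + g x ≡ ∑ xs g + f x
∑-update {xs = _ ∷ xs} {x} f g (x# ∷ _) (here refl) eq
  rewrite ∑-cong-∈ xs {f} {g} (λ y∈ → eq (All.lookup x# y∈ ∘ sym)) =
  solve 3 (λ a b c → (a :+ b) :+ c := (c :+ b) :+ a) refl (f x) (∑ xs g) (g x)
  where open +-*-Solver
∑-update {xs = y ∷ xs} {x} f g (y# ∷ u) (there x∈) eq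
  rewrite eq (All.lookup y# x∈) | +-assoc (g y) (∑ xs f) (g x) | ∑-update f g u x∈ eq =
  sym (+-assoc (g y) (∑ xs g) (f x))

length-filter≡∑ : ∀ {P : Pred A 0ℓ} (P? : Decidable P) xs →
                  length (filter P? xs) ≡ count xs (does ∘ P?)
length-filter≡∑ P? []       = refl
length-filter≡∑ P? (x ∷ xs) with does (P? x)
... | true  = cong suc (length-filter≡∑ P? xs)
... | false = length-filter≡∑ P? xs

∑-filter : ∀ {P : Pred A 0ℓ} (P? : Decidable P) xs (f : A → ℕ) →
           ∑ (filter P? xs) f ≡ ∑ xs (λ x → ⟦ does (P? x) ⟧ * f x)
∑-filter P? []       f = refl
∑-filter P? (x ∷ xs) f with does (P? x)
... | true  rewrite +-identityʳ (f x) = cong (f x +_) (∑-filter P? xs f)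
... | false = ∑-filter P? xs f

length-mono-⊆ : ∀ {xs ys : List A} → Unique xs → (∀ {x} → x ∈ xs → x ∈ ys) → length xs ≤ length ys
length-mono-⊆ {xs = []}     _        _  = z≤n
length-mono-⊆ {xs = x ∷ xs} (x# ∷ u) sub with ∈-∃++ (sub (here refl))
... | as , bs , refl = begin
  suc (length xs)                ≤⟨ s≤s (length-mono-⊆ u sub′) ⟩
  suc (length (as ++ bs))        ≡⟨ cong suc (List.length-++ as) ⟩
  suc (length as + length bs)    ≡⟨ +-suc (length as) (length bs) ⟨
  length as + suc (length bs)    ≡⟨ List.length-++ as ⟨
  length (as ++ x ∷ bs)          ∎
  where
  open ≤-Reasoning
  sub′ : ∀ {y} → y ∈ xs → y ∈ as ++ bs
  sub′ y∈ with ∈-++⁻ as (sub (there y∈))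
  ... | inj₁ p           = ∈-++⁺ˡ p
  ... | inj₂ (here refl) = contradiction refl (All.lookup x# y∈)
  ... | inj₂ (there p)   = ∈-++⁺ʳ as p

length-filter-true : ∀ (P : A → Bool) xs → length (filter (λ x → P x ≟ᵇ true) xs) ≡ count xs P
length-filter-true P xs = trans (length-filter≡∑ _ xs) (∑-cong xs λ x → does-true (P x))
  where
  does-true : ∀ b → ⟦ does (b ≟ᵇ true) ⟧ ≡ ⟦ b ⟧
  does-true true  = refl
  does-true false = refl

length≤count : ∀ {xs ys : List A} {P : A → Bool} → Unique xs →
               (∀ {x} → x ∈ xs → x ∈ ys × P x ≡ true) → length xs ≤ count ys P
length≤count {xs = xs} {ys} {P} u sub = begin
  length xs              ≤⟨ length-mono-⊆ u (λ x∈ → ∈-filter⁺ P? (proj₁ (sub x∈)) (proj₂ (sub x∈))) ⟩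
  length (filter P? ys)  ≡⟨ length-filter-true P ys ⟩
  count ys P             ∎
  where
  open ≤-Reasoning
  P? = λ x → P x ≟ᵇ true

count≤length : ∀ {xs ys : List A} {P : A → Bool} → Unique ys →
               (∀ {x} → P x ≡ true → x ∈ xs) → count ys P ≤ length xs
count≤length {xs = xs} {ys} {P} u sup = begin
  count ys P             ≡⟨ length-filter-true P ys ⟨
  length (filter P? ys)  ≤⟨ length-mono-⊆ (Unique.filter⁺ P? u) (λ x∈ → sup (proj₂ (∈-filter⁻ P? {xs = ys} x∈))) ⟩
  length xs              ∎
  where
  open ≤-Reasoning
  P? = λ x → P x ≟ᵇ true

-- Sets of vertices and their sizes

Subset : ℕ → Set
Subset n = Fin n → Bool

infixl 6 _⊕_

-- Symmetric difference with a singleton, so it both adds and removes a vertex. Written with `xor`,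
-- it turns the rearrangements of sets needed along alternating paths into Boolean ring identities.
_⊕_ : Subset n → Fin n → Subset n
(S ⊕ x) y = S y xor does (y ≟ x)

# : Subset n → ℕ
# {n} S = count (allFin n) S

⊕-at : ∀ (S : Subset n) x → (S ⊕ x) x ≡ not (S x)
⊕-at S x with x ≟ x
... | no x≢x = contradiction refl x≢x
... | yes _ with S x
... | true  = refl
... | false = refl

⊕-off : ∀ (S : Subset n) {x y} → y ≢ x → (S ⊕ x) y ≡ S y
⊕-off S {x} {y} y≢x with y ≟ x
... | yes y≡x = contradiction y≡x y≢x
... | no  _ with S y
... | true  = refl
... | false = refl

#-⊕ : ∀ (S : Subset n) x → # (S ⊕ x) + ⟦ S x ⟧ ≡ # S + ⟦ not (S x) ⟧
#-⊕ {n} S x = trans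
  (∑-update (⟦_⟧ ∘ (S ⊕ x)) (⟦_⟧ ∘ S) (Unique.allFin⁺ n) (∈-allFin x) (cong ⟦_⟧ ∘ ⊕-off S))
  (cong (λ b → # S + ⟦ b ⟧) (⊕-at S x))

#-add : ∀ (S : Subset n) x → S x ≡ false → # (S ⊕ x) ≡ suc (# S)
#-add S x eq with #-⊕ S x
... | p rewrite eq | +-identityʳ (# (S ⊕ x)) | +-comm (# S) 1 = p

#-remove : ∀ (S : Subset n) x → S x ≡ true → suc (# (S ⊕ x)) ≡ # S
#-remove S x eq with #-⊕ S x
... | p rewrite eq | +-identityʳ (# S) | +-comm (# (S ⊕ x)) 1 = p

⊆⇒#≤ : ∀ {S R : Subset n} → (∀ {x} → S x ≡ true → R x ≡ true) → # S ≤ # R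
⊆⇒#≤ {n} sub = ∑-mono (allFin n) λ _ → ⟦⟧-mono sub

#-∅ : # {n} (λ _ → false) ≡ 0
#-∅ {n} = ∑-zero (allFin n)

#-singleton : ∀ (x : Fin n) → # (λ y → does (y ≟ x)) ≡ 1
#-singleton {n} x = trans (#-add (λ _ → false) x refl) (cong suc (#-∅ {n}))

Unique-map-reflect : ∀ {A B C : Set} {f : A → B} {g : A → C} {xs} → (∀ {x y} → g x ≡ g y → f x ≡ f y) →
                     Unique (map f xs) → Unique (map g xs)
Unique-map-reflect reflects u = AllPairs.map⁺ (AllPairs.map (λ f≢ → f≢ ∘ reflects) (AllPairs.map⁻ u))

-- Merging labels along edges

module Merging {A : Set} {m : ℕ} (source target : A → Fin m) where

  Labelling : Set
  Labelling = Fin m → Fin m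

  merge : Labelling → A → Labelling
  merge ψ e x = if does (ψ x ≟ ψ (target e)) then ψ (source e) else ψ x

  gain : Labelling → A → ℕ
  gain ψ e = if does (ψ (source e) ≟ ψ (target e)) then 0 else 1

  -- The last edge of the list is merged first.
  labels : Labelling → List A → Labelling
  labels φ []      = φ
  labels φ (e ∷ L) = merge (labels φ L) e

  -- For `φ = id` this is the rank in the cycle matroid, the size of a spanning forest; a coarser
  -- `φ` contracts in advance whatever it identifies.
  rank : Labelling → List A → ℕ
  rank φ []      = 0
  rank φ (e ∷ L) = gain (labels φ L) e + rank φ L

  labels-++ : ∀ φ K L → labels φ (K ++ L) ≡ labels (labels φ L) K
  labels-++ φ []      L = refl
  labels-++ φ (e ∷ K) L = cong (λ ψ → merge ψ e) (labels-++ φ K L)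

  rank-++ : ∀ φ K L → rank φ (K ++ L) ≡ rank (labels φ L) K + rank φ L
  rank-++ φ []      L = refl
  rank-++ φ (e ∷ K) L rewrite labels-++ φ K L | rank-++ φ K L =
    sym (+-assoc (gain (labels (labels φ L) K) e) _ _)

  merge-≡ : ∀ ψ e {x y} → ψ x ≡ ψ y → merge ψ e x ≡ merge ψ e y
  merge-≡ ψ e eq rewrite eq = refl

  labels-≡ : ∀ φ L {x y} → φ x ≡ φ y → labels φ L x ≡ labels φ L y
  labels-≡ φ []      eq = eq
  labels-≡ φ (e ∷ L) eq = merge-≡ (labels φ L) e (labels-≡ φ L eq)

  merge-joins : ∀ ψ e → merge ψ e (source e) ≡ merge ψ e (target e)
  merge-joins ψ e with ψ (source e) ≟ ψ (target e) | ψ (target e) ≟ ψ (target e)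
  ... | yes _ | yes _ = refl
  ... | no  _ | yes _ = refl
  ... | _     | no ≢  = contradiction refl ≢

  labels-joins : ∀ φ {L e} → e ∈ L → labels φ L (source e) ≡ labels φ L (target e)
  labels-joins φ {e ∷ L} (here refl) = merge-joins (labels φ L) e
  labels-joins φ {e ∷ L} (there e∈)  = merge-≡ (labels φ L) e (labels-joins φ e∈)

  -- Merging generates the least equivalence that contains `φ` and the edges, so points that `R`
  -- separates keep different labels.
  labels-sound : ∀ φ L {R : Fin m → Fin m → Set} → IsEquivalence R →
                 (∀ {x y} → φ x ≡ φ y → R x y) →
                 (∀ {e} → e ∈ L → R (source e) (target e)) →
                 ∀ {x y} → labels φ L x ≡ labels φ L y → R x y
  labels-sound φ []      R-equiv base step = base
  labels-sound φ (e ∷ L) R-equiv base step {x} {y} eq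
    with labels φ L x ≟ labels φ L (target e) | labels φ L y ≟ labels φ L (target e)
  ... | yes p | yes q = sound (trans p (sym q))
    where sound = labels-sound φ L R-equiv base (step ∘ there)
  ... | yes p | no  q = E.trans (sound p) (E.trans (E.sym (step (here refl))) (sound eq))
    where module E = IsEquivalence R-equiv
          sound = labels-sound φ L R-equiv base (step ∘ there)
  ... | no  p | yes q = E.trans (sound eq) (E.trans (step (here refl)) (sound (sym q)))
    where module E = IsEquivalence R-equiv
          sound = labels-sound φ L R-equiv base (step ∘ there)
  ... | no  p | no  q = labels-sound φ L R-equiv base (step ∘ there) eq

  -- Each merge costs at most one element of a system of distinct representatives.
  survivors : ∀ {B : Set} (k : B → Fin m) φ L R → Unique (map (φ ∘ k) R) →
              ∃ λ R′ → Unique (map (labels φ L ∘ k) R′) × length R ≤ length R′ + rank φ L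
  survivors k φ []      R u = R , u , m≤m+n (length R) 0
  survivors k φ (e ∷ L) R u with survivors k φ L R u
  ... | R′ , u′ , le with labels φ L (source e) ≟ labels φ L (target e)
  ... | yes p = R′ , subst Unique (List.map-cong same R′) u′ , le
    where
    same : ∀ x → labels φ L (k x) ≡ merge (labels φ L) e (k x)
    same x with labels φ L (k x) ≟ labels φ L (target e)
    ... | yes q = trans q (sym p)
    ... | no  _ = refl
  ... | no  _ = R″ , u″ , (begin
    length R                              ≤⟨ le ⟩
    length R′ + rank φ L                  ≤⟨ +-monoˡ-≤ (rank φ L) (drop R′ u′) ⟩
    suc (length R″ + rank φ L)            ≡⟨ +-suc (length R″) (rank φ L) ⟨
    length R″ + suc (rank φ L)            ∎)
    where
    open ≤-Reasoning
    ψ = labels φ L ∘ k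
    off? = λ x → ¬? (ψ x ≟ labels φ L (target e))
    R″ = filter off? R′
    keep : ∀ x → ψ x ≢ labels φ L (target e) → merge (labels φ L) e (k x) ≡ ψ x
    keep x ne with ψ x ≟ labels φ L (target e)
    ... | yes q = contradiction q ne
    ... | no  _ = refl
    all-off : ∀ {xs} → All (λ z → labels φ L (target e) ≢ z) (map ψ xs) → length xs ≤ length (filter off? xs)
    all-off {[]}     []       = z≤n
    all-off {x ∷ xs} (ne ∷ a) with ψ x ≟ labels φ L (target e)
    ... | yes q = contradiction (sym q) ne
    ... | no  _ = s≤s (all-off a)
    drop : ∀ xs → Unique (map ψ xs) → length xs ≤ suc (length (filter off? xs))
    drop []       _        = z≤n
    drop (x ∷ xs) (x# ∷ u) with ψ x ≟ labels φ L (target e)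
    ... | yes q = s≤s (all-off (subst (λ z → All (z ≢_) (map ψ xs)) q x#))
    ... | no  _ = s≤s (drop xs u)
    u″ : Unique (map (merge (labels φ L) e ∘ k) R″)
    u″ = subst Unique (List.map-cong-local (All.map (λ {x} ne → sym (keep x ne)) (All.all-filter off? R′)))
           (AllPairs.map⁺ (AllPairs.filter⁺ off? (AllPairs.map⁻ u′)))

  -- `X′` collects the labels of `X` still in use. Each merge of two different labels discards that
  -- of the target, and both labels come from `X`.
  rank-≤ : ∀ φ L (X : Subset m) →
           (∀ {e} → e ∈ L → φ (source e) ≢ φ (target e) → X (φ (source e)) ≡ true × X (φ (target e)) ≡ true) →
           ∃ λ X′ → (∀ x → X (φ x) ≡ true → X′ (labels φ L x) ≡ true) × rank φ L + # X′ ≤ # X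
  rank-≤ φ []      X h = X , (λ _ p → p) , ≤-refl
  rank-≤ φ (e ∷ L) X h with rank-≤ φ L X (h ∘ there)
  ... | X′ , sub , le with labels φ L (source e) ≟ labels φ L (target e)
  ... | yes p = X′ , sub′ , le
    where
    sub′ : ∀ x → X (φ x) ≡ true → X′ (merge (labels φ L) e x) ≡ true
    sub′ x Xx with labels φ L x ≟ labels φ L (target e)
    ... | yes q = trans (cong X′ (trans p (sym q))) (sub x Xx)
    ... | no  _ = sub x Xx
  ... | no ne = X′ ⊕ ψ (target e) , sub′ , ≤-trans (≤-reflexive size) le
    where
    ψ = labels φ L
    -- Labels that differ after the merging of `L` differed under `φ` already.
    both = h (here refl) (ne ∘ labels-≡ φ L)
    size : suc (rank φ L) + # (X′ ⊕ ψ (target e)) ≡ rank φ L + # X′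
    size = trans (sym (+-suc (rank φ L) _)) (cong (rank φ L +_) (#-remove X′ (ψ (target e)) (sub _ (proj₂ both))))
    sub′ : ∀ x → X (φ x) ≡ true → (X′ ⊕ ψ (target e)) (merge ψ e x) ≡ true
    sub′ x Xx with ψ x ≟ ψ (target e)
    ... | yes q = trans (⊕-off X′ ne) (sub _ (proj₁ both))
    ... | no  q = trans (⊕-off X′ q) (sub x Xx)

  -- The points of `Q` end with distinct labels, all of them among the survivors of `X`. This is the
  -- bound of a spanning forest by vertices minus components.
  rank-≤-classes : ∀ φ L (X : Subset m) Q →
                   (∀ {e} → e ∈ L → φ (source e) ≢ φ (target e) → X (φ (source e)) ≡ true × X (φ (target e)) ≡ true) →
                   (∀ {q} → q ∈ Q → X (φ q) ≡ true) → Unique (map (labels φ L) Q) →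
                   rank φ L + length Q ≤ # X
  rank-≤-classes φ L X Q h XQ u with rank-≤ φ L X h
  ... | X′ , sub , le = ≤-trans (+-monoʳ-≤ (rank φ L) Q≤) le
    where
    in-X′ : ∀ {z} → z ∈ map (labels φ L) Q → z ∈ _ × X′ z ≡ true
    in-X′ {z} z∈ with ∈-map⁻ (labels φ L) z∈
    ... | q , q∈ , refl = ∈-allFin z , sub q (XQ q∈)
    Q≤ : length Q ≤ # X′
    Q≤ = subst (_≤ # X′) (List.length-map (labels φ L) Q) (length≤count u in-X′)

-- Darts and rotation systems

module Darts {n : ℕ} (G : Graph n) where

  open Graph G using (adj)
  open Dart public using (tail; head; joined)

  reverse : Dart G → Dart G
  reverse = Defs.reverse G

  ends : Dart G → Fin n × Fin n
  ends d = tail d , head d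

  ends-injective : ∀ {d e} → ends d ≡ ends e → d ≡ e
  ends-injective {dart u v p} {dart .u .v q} refl = cong (dart u v) (T-irrelevant p q)

  reverse-involutive : ∀ d → reverse (reverse d) ≡ d
  reverse-involutive d = ends-injective refl

  -- Taking the dart as a function of `T b` lets a plain case split on `b` supply the proof of
  -- adjacency.
  insert : ∀ b → (T b → Dart G) → List (Dart G) → List (Dart G)
  insert true  d ds = d _ ∷ ds
  insert false d ds = ds

  dartsOn : List (Fin n × Fin n) → List (Dart G)
  dartsOn []             = []
  dartsOn ((u , v) ∷ ps) = insert (adj u v) (dart u v) (dartsOn ps)

  joined? = λ (p : Fin n × Fin n) → T? (adj (proj₁ p) (proj₂ p))

  ends-dartsOn : ∀ ps → map ends (dartsOn ps) ≡ filter joined? ps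
  ends-dartsOn []               = refl
  ends-dartsOn (p@(u , v) ∷ ps) = begin
    map ends (insert (adj u v) (dart u v) (dartsOn ps))                       ≡⟨ ends-insert (adj u v) (λ _ → refl) ⟩
    (if adj u v then p ∷ map ends (dartsOn ps) else map ends (dartsOn ps))
      ≡⟨ cong (λ qs → if adj u v then p ∷ qs else qs) (ends-dartsOn ps) ⟩
    (if adj u v then p ∷ filter joined? ps else filter joined? ps)            ≡⟨ filter-∷ ⟨
    filter joined? (p ∷ ps)                                                   ∎
    where
    open ≡-Reasoning
    ends-insert : ∀ b {d : T b → Dart G} → (∀ t → ends (d t) ≡ p) →
                  map ends (insert b d (dartsOn ps)) ≡ (if b then p ∷ map ends (dartsOn ps) else map ends (dartsOn ps))
    ends-insert true  eq = cong (_∷ _) (eq _)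
    ends-insert false eq = refl
    filter-∷ : filter joined? (p ∷ ps) ≡ (if adj u v then p ∷ filter joined? ps else filter joined? ps)
    filter-∷ with adj u v
    ... | true  = refl
    ... | false = refl

  pairs : List (Fin n × Fin n)
  pairs = cartesianProduct (allFin n) (allFin n)

  darts : List (Dart G)
  darts = dartsOn pairs

  darts-unique : Unique darts
  darts-unique = Unique.map⁻ (subst Unique (sym (ends-dartsOn pairs))
    (Unique.filter⁺ joined? (Unique.cartesianProduct⁺ (Unique.allFin⁺ n) (Unique.allFin⁺ n))))

  ∈-darts : ∀ d → d ∈ darts
  ∈-darts d with ∈-map⁻ ends {xs = darts} (subst (ends d ∈_) (sym (ends-dartsOn pairs))
                   (∈-filter⁺ joined? (∈-cartesianProduct⁺ (∈-allFin (tail d)) (∈-allFin (head d))) (joined d)))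
  ... | e , e∈ , eq = subst (_∈ darts) (sym (ends-injective eq)) e∈

  ∑-cartesianProduct : ∀ {A B : Set} (xs : List A) (ys : List B) (f : A × B → ℕ) →
                       ∑ (cartesianProduct xs ys) f ≡ ∑ xs (λ x → ∑ ys (λ y → f (x , y)))
  ∑-cartesianProduct []       ys f = refl
  ∑-cartesianProduct (x ∷ xs) ys f = begin
    ∑ (map (x ,_) ys ++ cartesianProduct xs ys) f            ≡⟨ ∑-++ (map (x ,_) ys) _ f ⟩
    ∑ (map (x ,_) ys) f + ∑ (cartesianProduct xs ys) f       ≡⟨ cong₂ _+_ (∑-map (x ,_) ys f) (∑-cartesianProduct xs ys f) ⟩
    ∑ ys (λ y → f (x , y)) + ∑ xs (λ x → ∑ ys λ y → f (x , y)) ∎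
    where open ≡-Reasoning

  count-tails : ∀ (S : Subset n) → count darts (S ∘ tail) ≡ ∑ (allFin n) (λ u → degree G u * ⟦ S u ⟧)
  count-tails S = begin
    ∑ darts (f ∘ ends)                                                   ≡⟨ ∑-map ends darts f ⟨
    ∑ (map ends darts) f                                                 ≡⟨ cong (λ ps → ∑ ps f) (ends-dartsOn pairs) ⟩
    ∑ (filter joined? pairs) f                                           ≡⟨ ∑-filter joined? pairs f ⟩
    ∑ pairs (λ p → ⟦ does (joined? p) ⟧ * f p)                           ≡⟨ ∑-cartesianProduct (allFin n) (allFin n) _ ⟩
    ∑ (allFin n) (λ u → ∑ (allFin n) λ v → ⟦ adj u v ⟧ * ⟦ S u ⟧)        ≡⟨ ∑-cong (allFin n) inner ⟩
    ∑ (allFin n) (λ u → degree G u * ⟦ S u ⟧)                            ∎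
    where
    open ≡-Reasoning
    f : Fin n × Fin n → ℕ
    f (u , _) = ⟦ S u ⟧
    inner : ∀ u → ∑ (allFin n) (λ v → ⟦ adj u v ⟧ * ⟦ S u ⟧) ≡ degree G u * ⟦ S u ⟧
    inner u = begin
      ∑ (allFin n) (λ v → ⟦ adj u v ⟧ * ⟦ S u ⟧)  ≡⟨ ∑-cong (allFin n) (λ v → *-comm ⟦ adj u v ⟧ ⟦ S u ⟧) ⟩
      ∑ (allFin n) (λ v → ⟦ S u ⟧ * ⟦ adj u v ⟧)  ≡⟨ ∑-*ˡ (allFin n) ⟦ S u ⟧ _ ⟩
      ⟦ S u ⟧ * ∑ (allFin n) (⟦_⟧ ∘ adj u)        ≡⟨ cong (⟦ S u ⟧ *_) (length-filter≡∑ (λ v → T? (adj u v)) (allFin n)) ⟨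
      ⟦ S u ⟧ * degree G u                        ≡⟨ *-comm ⟦ S u ⟧ _ ⟩
      degree G u * ⟦ S u ⟧                        ∎

  ∑-permute : ∀ (f g : Dart G → Dart G) → (∀ d → g (f d) ≡ d) → (∀ d → f (g d) ≡ d) →
              ∀ (h : Dart G → ℕ) → ∑ darts (h ∘ f) ≡ ∑ darts h
  ∑-permute f g gf fg h = trans (sym (∑-map f darts h)) (∑-↭ h (∼bag⇒↭ (unique∧set⇒bag
    (Unique.map⁺ (λ {x} {y} eq → trans (sym (gf x)) (trans (cong g eq) (gf y))) darts-unique) darts-unique
    (mk⇔ (λ _ → ∈-darts _) (λ _ → subst (_∈ map f darts) (fg _) (∈-map⁺ f (∈-darts (g _))))))))

  ∑-reverse : ∀ (h : Dart G → ℕ) → ∑ darts (h ∘ reverse) ≡ ∑ darts h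
  ∑-reverse = ∑-permute reverse reverse reverse-involutive reverse-involutive

module Rotation {n : ℕ} (G : Graph n) (ρ : RotationSystem G) where

  open Darts G
  open RotationSystem ρ

  ∑-next : ∀ (h : Dart G → ℕ) → ∑ darts (h ∘ next) ≡ ∑ darts h
  ∑-next = ∑-permute next (Inverse.from rotation) (Inverse.strictlyInverseʳ rotation) (Inverse.strictlyInverseˡ rotation)

  ∑-faceStep : ∀ (h : Dart G → ℕ) → ∑ darts (h ∘ faceStep) ≡ ∑ darts h
  ∑-faceStep h = trans (∑-reverse (h ∘ next)) (∑-next h)

  -- On a finite set a permutation cannot map a set into itself and an outside dart into it as well:
  -- `Z ∘ next` would then hold for more darts than `Z`.
  closed⇒invariant : ∀ (Z : Dart G → Bool) → (∀ d → Z d ≡ true → Z (next d) ≡ true) → ∀ d → Z (next d) ≡ Z d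
  closed⇒invariant Z closed d with Z d in Zd | Z (next d) in Znd
  ... | true  | true  = refl
  ... | false | false = refl
  ... | true  | false = contradiction (trans (sym (closed d Zd)) Znd) λ ()
  ... | false | true  = contradiction (∑-next (⟦_⟧ ∘ Z)) (<⇒≢ (∑-mono-< (λ e → ⟦⟧-mono (closed e)) (∈-darts d) lt) ∘ sym)
    where
    lt : ⟦ Z d ⟧ < ⟦ Z (next d) ⟧
    lt rewrite Zd | Znd = ≤-refl

  -- A vertex cut X and a face cut Y cannot meet in a single edge e: since faceStep carries
  -- reverse d to next d, X d ∧ Y d holds for as many darts d as X d ∧ Y (reverse d) does.
  orthogonal : ∀ (X Y : Dart G → Bool) → (∀ d → X (next d) ≡ X d) → (∀ d → Y (faceStep d) ≡ Y d) →
               ∀ e → X e ≡ true → X (reverse e) ≡ false → Y e ≡ true → Y (reverse e) ≡ false →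
               ¬ (∀ d → (d ≡ e ⊎ d ≡ reverse e) ⊎ (X d ≡ X (reverse d) ⊎ Y d ≡ Y (reverse d)))
  orthogonal X Y X-next Y-face e Xe Xre Ye Yre cases =
    contradiction sums (<⇒≢ (∑-mono-< le (∈-darts e) lt))
    where
    f g : Dart G → ℕ
    f d = ⟦ X d ∧ Y d ⟧
    g d = ⟦ X d ∧ Y (reverse d) ⟧
    ∑g≡∑f : ∑ darts g ≡ ∑ darts f
    ∑g≡∑f = begin
      ∑ darts g               ≡⟨ ∑-reverse g ⟨
      ∑ darts (g ∘ reverse)   ≡⟨ ∑-cong darts (λ d → cong₂ (λ x y → ⟦ x ∧ y ⟧) (sym (X-next (reverse d)))
                                  (trans (cong Y (reverse-involutive d)) (sym (Y-face d)))) ⟩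
      ∑ darts (f ∘ faceStep)  ≡⟨ ∑-faceStep f ⟩
      ∑ darts f               ∎
      where open ≡-Reasoning
    -- Pairing each dart with its reverse allows a comparison edge by edge: the contributions agree
    -- wherever `X` or `Y` is constant on the edge, and at `e` they are 0 and 1.
    sums : ∑ darts (λ d → g d + g (reverse d)) ≡ ∑ darts (λ d → f d + f (reverse d))
    sums = begin
      ∑ darts (λ d → g d + g (reverse d))   ≡⟨ ∑-+ darts g (g ∘ reverse) ⟩
      ∑ darts g + ∑ darts (g ∘ reverse)     ≡⟨ cong₂ _+_ ∑g≡∑f (trans (∑-reverse g) (trans ∑g≡∑f (sym (∑-reverse f)))) ⟩
      ∑ darts f + ∑ darts (f ∘ reverse)     ≡⟨ ∑-+ darts f (f ∘ reverse) ⟨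
      ∑ darts (λ d → f d + f (reverse d))   ∎
      where open ≡-Reasoning
    lt : g e + g (reverse e) < f e + f (reverse e)
    lt rewrite Xe | Xre | Ye | Yre = s≤s z≤n
    le : ∀ d → g d + g (reverse d) ≤ f d + f (reverse d)
    le d with cases d
    ... | inj₁ (inj₁ refl) = <⇒≤ lt
    ... | inj₁ (inj₂ refl) rewrite Xre | cong X (reverse-involutive e) | Xe | cong (Y ∘ reverse) (reverse-involutive e) | Yre = z≤n
    ... | inj₂ (inj₁ Xd) rewrite cong Y (reverse-involutive d) | Xd = ≤-reflexive (+-comm ⟦ X (reverse d) ∧ Y (reverse d) ⟧ _)
    ... | inj₂ (inj₂ Yd) rewrite cong Y (reverse-involutive d) | Yd = ≤-refl

  -- `h` selects the edges that are kept. `Y` labels the faces of `G` after merging across the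
  -- deleted edges, so its values stand for faces of the subgraph.
  module Subgraph (h : Dart G → Bool) (h-reverse : ∀ d → h (reverse d) ≡ h d)
                  {F : ℕ} (Y : Dart G → Fin F) (Y-face : ∀ d → Y (faceStep d) ≡ Y d)
                  (Y-reverse : ∀ d → h d ≡ false → Y (reverse d) ≡ Y d) where

    -- The dart of the subgraph after d in the facial walk of the subgraph.
    step : ∀ d → h d ≡ true → ∃ λ e → h e ≡ true × tail e ≡ head d × Y e ≡ Y d
    step d hd with Any.any? (λ e → (h e ≟ᵇ true) ×-dec (tail e ≟ head d) ×-dec (Y e ≟ Y d)) darts
    ... | yes p = let e , _ , q = find p in e , q
    -- Let `Z` be the darts at `head d` labelled `Y d`. If none of them is kept, `Z` is closed under
    -- rotation and so fills the whole vertex; but it would then contain `reverse d`, which is kept.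
    ... | no ¬p = contradiction hd (λ hd → Z⇒¬h (reverse d) Z-reverse (trans (h-reverse d) hd))
      where
      Z : Dart G → Bool
      Z e = does ((tail e ≟ head d) ×-dec (Y e ≟ Y d))
      Z⁻ : ∀ e → Z e ≡ true → tail e ≡ head d × Y e ≡ Y d
      Z⁻ e Ze with tail e ≟ head d | Y e ≟ Y d
      Z⁻ e Ze | yes p | yes q = p , q
      Z⁻ e () | yes p | no  _
      Z⁻ e () | no  _ | _
      Z⁺ : ∀ e → tail e ≡ head d → Y e ≡ Y d → Z e ≡ true
      Z⁺ e p q = dec-true ((tail e ≟ head d) ×-dec (Y e ≟ Y d)) (p , q)
      Z⇒¬h : ∀ e → Z e ≡ true → h e ≢ true
      Z⇒¬h e Ze he = ¬p (lose (∈-darts e) (he , Z⁻ e Ze))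
      Z-closed : ∀ e → Z e ≡ true → Z (next e) ≡ true
      Z-closed e Ze with h e in he | Z⁻ e Ze
      ... | true  | _     = contradiction he (Z⇒¬h e Ze)
      -- Since `e` is deleted, `Y` agrees on its two darts, and `next e` continues the facial walk
      -- of `reverse e`.
      ... | false | p , q = Z⁺ (next e) (trans (tail-next e) p) (begin
        Y (next e)                ≡⟨ cong (Y ∘ next) (reverse-involutive e) ⟨
        Y (faceStep (reverse e))  ≡⟨ Y-face (reverse e) ⟩
        Y (reverse e)             ≡⟨ Y-reverse e he ⟩
        Y e                       ≡⟨ q ⟩
        Y d                       ∎)
        where open ≡-Reasoning
      Z-class : ∀ {x y} → Equivalence.EqClosure (Step next) x y → Z x ≡ Z y
      Z-class = Equivalence.fold (On.isEquivalence Z ≡.isEquivalence) Z-step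
        where
        Z-step : ∀ {x y} → Step next x y → Z x ≡ Z y
        Z-step {x} refl = sym (closed⇒invariant Z Z-closed x)
      Z-reverse : Z (reverse d) ≡ true
      Z-reverse = trans (Z-class (transitive (reverse d) (faceStep d) (sym (tail-next (reverse d)))))
                        (Z⁺ (faceStep d) (tail-next (reverse d)) (Y-face d))

    -- Only faces with a different face across some kept edge take part in the dual rank. Other
    -- faces may have fewer than three darts: the one face around a single edge has two.
    boundary : Subset F
    boundary ℓ = does (Any.any? (λ d → (h d ≟ᵇ true) ×-dec (Y d ≟ ℓ) ×-dec ¬? (Y (reverse d) ≟ ℓ)) darts)

    boundary⁺ : ∀ d → h d ≡ true → Y d ≢ Y (reverse d) → boundary (Y d) ≡ true
    boundary⁺ d hd ne = dec-true (Any.any? _ darts) (lose (∈-darts d) (hd , refl , ne ∘ sym))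

    -- The walk d, d₂, d₃ cannot close up after two steps: the graph is simple, and d₂ ≢ reverse d.
    three-darts : ∀ ℓ → 3 * ⟦ boundary ℓ ⟧ ≤ count darts (λ d → h d ∧ does (ℓ ≟ Y d))
    three-darts ℓ with Any.any? (λ d → (h d ≟ᵇ true) ×-dec (Y d ≟ ℓ) ×-dec ¬? (Y (reverse d) ≟ ℓ)) darts
    ... | no _  = z≤n
    ... | yes p with find p
    ... | d , _ , hd , refl , ne with step d hd
    ... | d₂ , hd₂ , t₂ , Y₂ with step d₂ hd₂
    ... | d₃ , hd₃ , t₃ , Y₃ = length≤count {xs = d ∷ d₂ ∷ d₃ ∷ []} unique λ where
        (here refl)                 → good d hd refl
        (there (here refl))         → good d₂ hd₂ Y₂
        (there (there (here refl))) → good d₃ hd₃ (trans Y₃ Y₂)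
      where
      good : ∀ e → h e ≡ true → Y e ≡ Y d → e ∈ darts × h e ∧ does (Y d ≟ Y e) ≡ true
      good e he eq rewrite he = ∈-darts e , dec-true (Y d ≟ Y e) (sym eq)
      tail≢head : ∀ (e : Dart G) → tail e ≢ head e
      tail≢head (dart u .u uu) refl = Graph.irrefl G uu
      tails≢ : ∀ {e e′ : Dart G} → tail e′ ≡ head e → e ≢ e′
      tails≢ {e} t refl = tail≢head e t
      d≢d₃ : d ≢ d₃
      d≢d₃ refl = ne (trans (cong Y (ends-injective (cong₂ _,_ (sym t₂) t₃))) Y₂)
      unique : Unique (d ∷ d₂ ∷ d₃ ∷ [])
      unique = (tails≢ t₂ ∷ d≢d₃ ∷ [])
             ∷ (tails≢ t₃ ∷ []) ∷ [] ∷ []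

    3*boundary≤ : 3 * # boundary ≤ count darts h
    3*boundary≤ = begin
      3 * # boundary                                                        ≡⟨ ∑-*ˡ (allFin F) 3 _ ⟨
      ∑ (allFin F) (λ ℓ → 3 * ⟦ boundary ℓ ⟧)                               ≤⟨ ∑-mono (allFin F) three-darts ⟩
      ∑ (allFin F) (λ ℓ → ∑ darts λ d → ⟦ h d ∧ does (ℓ ≟ Y d) ⟧)           ≡⟨ ∑-swap (allFin F) darts _ ⟩
      ∑ darts (λ d → ∑ (allFin F) λ ℓ → ⟦ h d ∧ does (ℓ ≟ Y d) ⟧)           ≡⟨ ∑-cong darts (λ d → one (h d) (Y d)) ⟩
      count darts h                                                         ∎
      where
      open ≤-Reasoning
      one : ∀ b y → ∑ (allFin F) (λ ℓ → ⟦ b ∧ does (ℓ ≟ y) ⟧) ≡ ⟦ b ⟧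
      one true  y = #-singleton y
      one false y = ∑-zero (allFin F)

-- Euler's formula for subgraphs

module Classes {A : Set} {R : Rel A 0ℓ} {k : ℕ} (classes : HasClasses R k) where

  open Bijection classes using (to; injective; strictlySurjective) public
    renaming (cong to to-cong)

  rep : Fin k → A
  rep i = proj₁ (strictlySurjective i)

  to-rep : ∀ i → to (rep i) ≡ i
  to-rep i = proj₂ (strictlySurjective i)

  reps : List A
  reps = map rep (allFin k)

  length-reps : length reps ≡ k
  length-reps = trans (List.length-map rep (allFin k)) (List.length-tabulate id)

  rep-related : ∀ x → Equivalence.EqClosure R (rep (to x)) x
  rep-related x = injective (to-rep (to x))

  reps-unique : ∀ {B : Set} (f : A → B) → (∀ {x y} → f x ≡ f y → Equivalence.EqClosure R x y) →
                Unique (map f reps)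
  reps-unique f f⇒R = Unique-map-reflect f⇒R′
    (subst Unique (trans (sym (List.map-id (allFin k))) (trans (List.map-cong (sym ∘ to-rep) (allFin k)) (List.map-∘ (allFin k))))
      (Unique.allFin⁺ k))
    where
    f⇒R′ : ∀ {x y} → f x ≡ f y → to x ≡ to y
    f⇒R′ = to-cong ∘ f⇒R

  length≤classes : ∀ {B : Set} (f : A → B) → (∀ {x y} → R x y → f x ≡ f y) →
                   ∀ {xs} → Unique (map f xs) → length xs ≤ k
  length≤classes f R⇒f {xs} u = begin
    length xs            ≡⟨ List.length-map to xs ⟨
    length (map to xs)   ≤⟨ length-mono-⊆ (Unique-map-reflect (R*⇒f ∘ injective) u) (λ {i} _ → ∈-allFin i) ⟩
    length (allFin k)    ≡⟨ List.length-tabulate id ⟩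
    k                    ∎
    where
    open ≤-Reasoning
    R*⇒f : ∀ {x y} → Equivalence.EqClosure R x y → f x ≡ f y
    R*⇒f = Equivalence.fold (On.isEquivalence f ≡.isEquivalence) R⇒f

∈-ʳ++ : ∀ {A : Set} {x : A} L {K} → x ∈ L ⊎ x ∈ K → x ∈ L ʳ++ K
∈-ʳ++ []      (inj₂ p)           = p
∈-ʳ++ (e ∷ L) (inj₁ (here refl)) = ∈-ʳ++ L (inj₂ (here refl))
∈-ʳ++ (e ∷ L) (inj₁ (there p))   = ∈-ʳ++ L (inj₁ p)
∈-ʳ++ (e ∷ L) (inj₂ p)           = ∈-ʳ++ L (inj₂ (there p))

module Sphere {n : ℕ} (G : Graph n) (ρ : RotationSystem G) (sphere : GenusZero G ρ) where

  open Darts G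
  open RotationSystem ρ
  open Rotation G ρ

  private
    V = proj₁ sphere
    E = proj₁ (proj₂ sphere)
    F = proj₁ (proj₂ (proj₂ sphere))
    C = proj₁ (proj₂ (proj₂ (proj₂ sphere)))
    classes = proj₂ (proj₂ (proj₂ (proj₂ sphere)))
    euler : V + F ≡ E + 2 * C
    euler = proj₂ (proj₂ (proj₂ (proj₂ classes)))
    module Vertices   = Classes (proj₁ classes)
    module Edges      = Classes (proj₁ (proj₂ classes))
    module Faces      = Classes (proj₁ (proj₂ (proj₂ classes)))
    module Components = Classes (proj₁ (proj₂ (proj₂ (proj₂ classes))))

  face : Dart G → Fin F
  face = Faces.to

  face-faceStep : ∀ d → face (faceStep d) ≡ face d
  face-faceStep d = Faces.to-cong (bwd refl ◅ ε)

  face-next : ∀ d → face (reverse d) ≡ face (next d)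
  face-next d = begin
    face (reverse d)             ≡⟨ face-faceStep (reverse d) ⟨
    face (faceStep (reverse d))  ≡⟨ cong (face ∘ next) (reverse-involutive d) ⟩
    face (next d)                ∎
    where open ≡-Reasoning

  -- The same darts serve as edges of `G` and as edges of the dual graph, which join the faces on
  -- their two sides.
  module Primal = Merging {Dart G} tail head
  module Dual   = Merging {Dart G} face (face ∘ reverse)

  reverse-class : ∀ {x y} → Equivalence.EqClosure (Step reverse) x y → x ≡ y ⊎ x ≡ reverse y
  reverse-class ε = inj₁ refl
  reverse-class (fwd refl ◅ p) with reverse-class p
  ... | inj₁ refl = inj₂ (sym (reverse-involutive _))
  ... | inj₂ eq   = inj₁ (trans (sym (reverse-involutive _)) (trans (cong reverse eq) (reverse-involutive _)))
  reverse-class (bwd refl ◅ p) with reverse-class p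
  ... | inj₁ refl = inj₂ refl
  ... | inj₂ eq   = inj₁ (trans (cong reverse eq) (reverse-involutive _))

  -- Lists of edges contain darts in an arbitrary direction, so membership is taken up to reversal.
  _∈±_ : Dart G → List (Dart G) → Set
  d ∈± L = ∃ λ e → e ∈ L × (e ≡ d ⊎ e ≡ reverse d)

  primal-joins : ∀ {L d} → d ∈± L → Primal.labels id L (tail d) ≡ Primal.labels id L (head d)
  primal-joins (_ , e∈ , inj₁ refl) = Primal.labels-joins id e∈
  primal-joins (_ , e∈ , inj₂ refl) = sym (Primal.labels-joins id e∈)

  dual-joins : ∀ {L d} → d ∈± L → Dual.labels id L (face d) ≡ Dual.labels id L (face (reverse d))
  dual-joins (_ , e∈ , inj₁ refl) = Dual.labels-joins id e∈
  dual-joins {L} {d} (_ , e∈ , inj₂ refl) =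
    sym (trans (Dual.labels-joins id e∈) (cong (Dual.labels id L ∘ face) (reverse-involutive d)))

  -- If both gains were 1, the component of `tail e` under `K` and the merged class of `face e`
  -- under `L` would define a vertex cut and a face cut. All edges other than `e` belong to `K` or
  -- `L` and avoid one of the two, which `orthogonal` forbids.
  gains≤1 : ∀ e L K → (∀ d → d ∈± (e ∷ []) ⊎ (d ∈± L ⊎ d ∈± K)) →
            Primal.gain (Primal.labels id K) e + Dual.gain (Dual.labels id L) e ≤ 1
  gains≤1 e L K cover
    with Primal.labels id K (tail e) ≟ Primal.labels id K (head e)
       | Dual.labels id L (face e) ≟ Dual.labels id L (face (reverse e))
  ... | yes _ | yes _ = z≤n
  ... | yes _ | no  _ = ≤-refl
  ... | no  _ | yes _ = ≤-refl
  ... | no  p | no  q = contradiction cases (orthogonal X Y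
        (λ d → cong (λ v → does (φ v ≟ φ (tail e))) (tail-next d))
        (λ d → cong (λ f → does (ψ f ≟ ψ (face e))) (face-faceStep d))
        e (dec-true (φ (tail e) ≟ φ (tail e)) refl) (dec-false (φ (head e) ≟ φ (tail e)) (p ∘ sym))
          (dec-true (ψ (face e) ≟ ψ (face e)) refl) (dec-false (ψ (face (reverse e)) ≟ ψ (face e)) (q ∘ sym)))
    where
    φ = Primal.labels id K
    ψ = Dual.labels id L
    X Y : Dart G → Bool
    X d = does (φ (tail d) ≟ φ (tail e))
    Y d = does (ψ (face d) ≟ ψ (face e))
    cases : ∀ d → (d ≡ e ⊎ d ≡ reverse e) ⊎ (X d ≡ X (reverse d) ⊎ Y d ≡ Y (reverse d))
    cases d with cover d
    ... | inj₁ (_ , here refl , inj₁ refl) = inj₁ (inj₁ refl)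
    ... | inj₁ (_ , here refl , inj₂ eq) = inj₁ (inj₂ (trans (sym (reverse-involutive d)) (cong reverse (sym eq))))
    ... | inj₂ (inj₁ d∈L) = inj₂ (inj₂ (cong (λ l → does (l ≟ ψ (face e))) (dual-joins d∈L)))
    ... | inj₂ (inj₂ d∈K) = inj₂ (inj₁ (cong (λ l → does (l ≟ φ (tail e))) (primal-joins d∈K)))

  -- The edges of L are added to K in their order, and merge faces in the opposite order.
  primal+dual : ∀ L K → (∀ d → d ∈± L ⊎ d ∈± K) →
                Primal.rank id (L ʳ++ K) + Dual.rank id L ≤ Primal.rank id K + length L
  primal+dual []      K cover = ≤-refl
  primal+dual (e ∷ L) K cover = begin
    P′ + (gᵈ + Dual.rank id L)                    ≡⟨ x∙yz≈y∙xz P′ gᵈ _ ⟩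
    gᵈ + (P′ + Dual.rank id L)                    ≤⟨ +-monoʳ-≤ gᵈ (primal+dual L (e ∷ K) cover′) ⟩
    gᵈ + (gᵖ + Primal.rank id K + length L)
      ≡⟨ solve 4 (λ a b c d → a :+ (b :+ c :+ d) := (b :+ a) :+ (c :+ d)) refl gᵈ gᵖ (Primal.rank id K) (length L) ⟩
    (gᵖ + gᵈ) + (Primal.rank id K + length L)     ≤⟨ +-monoˡ-≤ _ (gains≤1 e L K cover″) ⟩
    suc (Primal.rank id K + length L)             ≡⟨ +-suc (Primal.rank id K) (length L) ⟨
    Primal.rank id K + suc (length L)             ∎
    where
    open ≤-Reasoning
    open +-*-Solver
    P′ = Primal.rank id (L ʳ++ (e ∷ K))
    gᵖ = Primal.gain (Primal.labels id K) e
    gᵈ = Dual.gain (Dual.labels id L) e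
    cover″ : ∀ d → d ∈± (e ∷ []) ⊎ (d ∈± L ⊎ d ∈± K)
    cover″ d with cover d
    ... | inj₁ (_ , here refl , eq) = inj₁ (_ , here refl , eq)
    ... | inj₁ (_ , there p , eq)   = inj₂ (inj₁ (_ , p , eq))
    ... | inj₂ d∈K                  = inj₂ (inj₂ d∈K)
    cover′ : ∀ d → d ∈± L ⊎ d ∈± (e ∷ K)
    cover′ d with cover″ d
    ... | inj₁ (_ , here refl , eq) = inj₂ (_ , here refl , eq)
    ... | inj₂ (inj₁ p)             = inj₁ p
    ... | inj₂ (inj₂ (_ , p , eq))  = inj₂ (_ , there p , eq)

  -- Merging along all edges leaves at most one vertex label for each component, and each unit of
  -- rank costs at most one label.
  V≤ : ∀ L → (∀ d → d ∈± L) → V ≤ C + Primal.rank id L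
  V≤ L cover with Primal.survivors tail id L Vertices.reps (Vertices.reps-unique tail (transitive _ _))
  ... | R , u , le = begin
    V                             ≡⟨ Vertices.length-reps ⟨
    length Vertices.reps          ≤⟨ le ⟩
    length R + Primal.rank id L   ≤⟨ +-monoˡ-≤ _ (Components.length≤classes (Primal.labels id L ∘ tail) invariant u) ⟩
    C + Primal.rank id L          ∎
    where
    open ≤-Reasoning
    invariant : ∀ {x y} → Step next x y ⊎ Step reverse x y → Primal.labels id L (tail x) ≡ Primal.labels id L (tail y)
    invariant {x} (inj₁ refl) = cong (Primal.labels id L) (sym (tail-next x))
    invariant {x} (inj₂ refl) = primal-joins (cover x)

  F≤ : ∀ L → (∀ d → d ∈± L) → F ≤ C + Dual.rank id L
  F≤ L cover with Dual.survivors face id L Faces.reps (Faces.reps-unique face Faces.injective)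
  ... | R , u , le = begin
    F                             ≡⟨ Faces.length-reps ⟨
    length Faces.reps             ≤⟨ le ⟩
    length R + Dual.rank id L     ≤⟨ +-monoˡ-≤ _ (Components.length≤classes (Dual.labels id L ∘ face) invariant u) ⟩
    C + Dual.rank id L            ∎
    where
    open ≤-Reasoning
    invariant : ∀ {x y} → Step next x y ⊎ Step reverse x y → Dual.labels id L (face x) ≡ Dual.labels id L (face y)
    invariant {x} (inj₂ refl) = dual-joins (cover x)
    -- Rotating from `x` to `next x` leads to the face across the edge of `x`, so the dual graph
    -- does not fall into more pieces than `G`.
    invariant {x} (inj₁ refl) = trans (dual-joins (cover x)) (cong (Dual.labels id L) (face-next x))

  -- The number of edges of a subgraph

  module _ (h : Dart G → Bool) (h-reverse : ∀ d → h (reverse d) ≡ h d) where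

    private
      h?  = λ d → h d ≟ᵇ true
      L₁ = filter h? Edges.reps
      L₂ = filter (¬? ∘ h?) Edges.reps

    ∈±-L₁ : ∀ d → h d ≡ true → d ∈± L₁
    ∈±-L₁ d hd with reverse-class (Edges.rep-related d)
    ... | inj₁ eq = _ , ∈-filter⁺ h? (∈-map⁺ Edges.rep (∈-allFin (Edges.to d))) (trans (cong h eq) hd) , inj₁ eq
    ... | inj₂ eq = _ , ∈-filter⁺ h? (∈-map⁺ Edges.rep (∈-allFin (Edges.to d)))
                          (trans (cong h eq) (trans (h-reverse d) hd)) , inj₂ eq

    ∈±-L₂ : ∀ d → h d ≡ false → d ∈± L₂
    ∈±-L₂ d hd with reverse-class (Edges.rep-related d)
    ... | inj₁ eq = _ , ∈-filter⁺ (¬? ∘ h?) (∈-map⁺ Edges.rep (∈-allFin (Edges.to d)))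
                          (λ hr → contradiction (trans (sym hd) (trans (cong h (sym eq)) hr)) λ ()) , inj₁ eq
    ... | inj₂ eq = _ , ∈-filter⁺ (¬? ∘ h?) (∈-map⁺ Edges.rep (∈-allFin (Edges.to d)))
                          (λ hr → contradiction (trans (sym (trans (h-reverse d) hd)) (trans (cong h (sym eq)) hr)) λ ()) , inj₂ eq

    length-split : ∀ xs → length (filter h? xs) + length (filter (¬? ∘ h?) xs) ≡ length xs
    length-split []       = refl
    length-split (x ∷ xs) with h? x
    ... | yes _ = cong suc (length-split xs)
    ... | no  _ = trans (+-suc _ _) (cong suc (length-split xs))

    cover : ∀ d → d ∈± L₂ ⊎ d ∈± L₁
    cover d with h d in hd
    ... | true  = inj₂ (∈±-L₁ d hd)
    ... | false = inj₁ (∈±-L₂ d hd)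

    -- Euler's formula for the kept edges, with ranks in place of V - C and F - C. For all edges
    -- together it comes from `euler`. By `primal+dual` the deleted edges raise `p + d₂` above `p₁`
    -- by at most their number, which cancels.
    length-L₁≤ : length L₁ ≤ Primal.rank id L₁ + Dual.rank (Dual.labels id L₂) L₁
    length-L₁≤ = +-cancelʳ-≤ (length L₂ + 2 * C) (length L₁) (p₁ + d₁) (begin
      length L₁ + (length L₂ + 2 * C)    ≡⟨ +-assoc (length L₁) _ _ ⟨
      (length L₁ + length L₂) + 2 * C    ≡⟨ cong (_+ 2 * C) (trans (length-split Edges.reps) Edges.length-reps) ⟩
      E + 2 * C                          ≡⟨ euler ⟨
      V + F
        ≤⟨ +-mono-≤ (V≤ (L₂ ʳ++ L₁) λ d → ±-map (∈-ʳ++ L₂) (cover d)) (F≤ (L₁ ++ L₂) λ d → ±-map ∈-++ (cover d)) ⟩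
      (C + p) + (C + Dual.rank id (L₁ ++ L₂)) ≡⟨ cong (λ r → (C + p) + (C + r)) (Dual.rank-++ id L₁ L₂) ⟩
      (C + p) + (C + (d₁ + d₂))
        ≡⟨ solve 4 (λ c p d₁ d₂ → (c :+ p) :+ (c :+ (d₁ :+ d₂)) := (p :+ d₂) :+ (d₁ :+ con 2 :* c)) refl C p d₁ d₂ ⟩
      (p + d₂) + (d₁ + 2 * C)            ≤⟨ +-monoˡ-≤ _ (primal+dual L₂ L₁ cover) ⟩
      (p₁ + length L₂) + (d₁ + 2 * C)
        ≡⟨ solve 4 (λ p₁ l d₁ c → (p₁ :+ l) :+ (d₁ :+ c) := (p₁ :+ d₁) :+ (l :+ c)) refl p₁ (length L₂) d₁ (2 * C) ⟩
      (p₁ + d₁) + (length L₂ + 2 * C)    ∎)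
      where
      open ≤-Reasoning
      open +-*-Solver
      p  = Primal.rank id (L₂ ʳ++ L₁)
      p₁ = Primal.rank id L₁
      d₁ = Dual.rank (Dual.labels id L₂) L₁
      d₂ = Dual.rank id L₂
      ±-map : ∀ {d L} → (∀ {e} → e ∈ L₂ ⊎ e ∈ L₁ → e ∈ L) → d ∈± L₂ ⊎ d ∈± L₁ → d ∈± L
      ±-map f (inj₁ (e , p , q)) = e , f (inj₁ p) , q
      ±-map f (inj₂ (e , p , q)) = e , f (inj₂ p) , q
      ∈-++ : ∀ {e : Dart G} → e ∈ L₂ ⊎ e ∈ L₁ → e ∈ L₁ ++ L₂
      ∈-++ = [ ∈-++⁺ʳ L₁ , ∈-++⁺ˡ ]

    private
      ψ = Dual.labels id L₂
      module S = Subgraph h h-reverse (ψ ∘ face) (λ d → cong ψ (face-faceStep d))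
                   (λ d hd → sym (dual-joins (∈±-L₂ d hd)))

    -- Merging across kept edges involves only labels in `S.boundary`, so the dual rank is at most
    -- their number, and each of them uses three darts.
    3*dual≤ : 3 * Dual.rank ψ L₁ ≤ count darts h
    3*dual≤ = ≤-trans (*-monoʳ-≤ 3 (≤-trans (m≤m+n _ 0) (Dual.rank-≤-classes ψ L₁ S.boundary [] boundary (λ ()) []))) S.3*boundary≤
      where
      boundary : ∀ {e} → e ∈ L₁ → ψ (face e) ≢ ψ (face (reverse e)) →
                 S.boundary (ψ (face e)) ≡ true × S.boundary (ψ (face (reverse e))) ≡ true
      boundary {e} e∈ ne = S.boundary⁺ e he ne ,
        S.boundary⁺ (reverse e) (trans (h-reverse e) he) (λ eq → ne (trans (cong (ψ ∘ face) (sym (reverse-involutive e))) (sym eq)))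
        where he = proj₂ (∈-filter⁻ h? {xs = Edges.reps} e∈)

    count≤2*L₁ : count darts h ≤ 2 * length L₁
    count≤2*L₁ = begin
      count darts h                          ≤⟨ count≤length darts-unique listed ⟩
      length (L₁ ++ map reverse L₁)          ≡⟨ List.length-++ L₁ ⟩
      length L₁ + length (map reverse L₁)    ≡⟨ cong (length L₁ +_) (trans (List.length-map reverse L₁) (sym (+-identityʳ _))) ⟩
      2 * length L₁                          ∎
      where
      open ≤-Reasoning
      listed : ∀ {d} → h d ≡ true → d ∈ L₁ ++ map reverse L₁
      listed {d} hd with ∈±-L₁ d hd
      ... | _ , e∈ , inj₁ refl = ∈-++⁺ˡ e∈
      ... | _ , e∈ , inj₂ refl = ∈-++⁺ʳ L₁ (subst (_∈ map reverse L₁) (reverse-involutive d) (∈-map⁺ reverse e∈))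

    -- The kept edges have their ends in `P`, and `Q` picks vertices from different components, as
    -- certified by an equivalence `R` that contains adjacency. In terms of edges the bound is three
    -- times the size of a spanning forest; it is weaker than 3V - 6, but holds for a single edge
    -- too.
    edge-bound : ∀ (P : Subset n) → (∀ d → h d ≡ true → P (tail d) ≡ true) →
                 ∀ {R : Fin n → Fin n → Set} → IsEquivalence R → (∀ d → h d ≡ true → R (tail d) (head d)) →
                 ∀ Q → (∀ {q} → q ∈ Q → P q ≡ true) → AllPairs (λ x y → ¬ R x y) Q →
                 count darts h + 6 * length Q ≤ 6 * # P
    edge-bound P tails R-equiv joins Q Q⊆P Q# = begin
      H + 6 * length Q            ≤⟨ +-monoˡ-≤ _ H≤ ⟩
      6 * p + 6 * length Q        ≡⟨ *-distribˡ-+ 6 p (length Q) ⟨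
      6 * (p + length Q)          ≤⟨ *-monoʳ-≤ 6 (Primal.rank-≤-classes id L₁ P Q (λ {e} e∈ _ → ends∈P e e∈) Q⊆P Q-labels) ⟩
      6 * # P                     ∎
      where
      open ≤-Reasoning
      open +-*-Solver
      H = count darts h
      p = Primal.rank id L₁
      d = Dual.rank ψ L₁
      in-h : ∀ {e} → e ∈ L₁ → h e ≡ true
      in-h e∈ = proj₂ (∈-filter⁻ h? {xs = Edges.reps} e∈)
      ends∈P : ∀ e → e ∈ L₁ → P (tail e) ≡ true × P (head e) ≡ true
      ends∈P e e∈ = tails e (in-h e∈) , tails (reverse e) (trans (h-reverse e) (in-h e∈))
      Q-labels : Unique (map (Primal.labels id L₁) Q)
      Q-labels = AllPairs.map⁺ (AllPairs.map (λ ¬R → ¬R ∘ Primal.labels-sound id L₁ R-equiv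
        (λ where refl → IsEquivalence.refl R-equiv) (λ {e} e∈ → joins e (in-h e∈))) Q#)
      H≤ : H ≤ 6 * p
      -- Two of the three copies of `H` pay for the dual rank, since 6d is at most 2H.
      H≤ = +-cancelʳ-≤ (2 * H) H (6 * p) (begin
        H + 2 * H               ≡⟨⟩
        3 * H                   ≤⟨ *-monoʳ-≤ 3 count≤2*L₁ ⟩
        3 * (2 * length L₁)     ≤⟨ *-monoʳ-≤ 3 (*-monoʳ-≤ 2 length-L₁≤) ⟩
        3 * (2 * (p + d))       ≡⟨ solve 2 (λ p d → con 3 :* (con 2 :* (p :+ d)) := con 6 :* p :+ con 2 :* (con 3 :* d)) refl p d ⟩
        6 * p + 2 * (3 * d)     ≤⟨ +-monoʳ-≤ (6 * p) (*-monoʳ-≤ 2 3*dual≤) ⟩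
        6 * p + 2 * H           ∎)

-- Matchable sets

infix 4 _⊆_

_⊆_ : Subset n → Subset n → Set
S ⊆ W = ∀ {x} → S x ≡ true → W x ≡ true

separated : ∀ {S : Subset n} {x y} → S x ≡ true → S y ≡ false → x ≢ y
separated Sx Sy refl = contradiction (trans (sym Sx) Sy) λ ()

⊈⇒∉ : ∀ {S W : Subset n} → S ⊆ W → ∀ {x} → W x ≡ false → S x ≡ false
⊈⇒∉ {S = S} sub {x} Wx with S x in Sx
... | false = refl
... | true  = contradiction (trans (sym (sub Sx)) Wx) λ ()

⊕-remove-at : ∀ {S : Subset n} {x} → S x ≡ true → (S ⊕ x) x ≡ false
⊕-remove-at {S = S} {x} Sx = trans (⊕-at S x) (cong not Sx)

⊕-remove-⊆ : ∀ {S : Subset n} {x} → S x ≡ true → S ⊕ x ⊆ S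
⊕-remove-⊆ {S = S} {x} Sx {v} Sxv =
  trans (sym (⊕-off S (separated {S = S ⊕ x} Sxv (⊕-remove-at {S = S} Sx)))) Sxv

module _ (S : Subset n) {x y : Fin n} where

  ⊕₂-off : ∀ {v} → v ≢ x → v ≢ y → (S ⊕ x ⊕ y) v ≡ S v
  ⊕₂-off v≢x v≢y = trans (⊕-off (S ⊕ x) v≢y) (⊕-off S v≢x)

  ⊕₂-at₁ : x ≢ y → (S ⊕ x ⊕ y) x ≡ not (S x)
  ⊕₂-at₁ x≢y = trans (⊕-off (S ⊕ x) x≢y) (⊕-at S x)

  ⊕₂-at₂ : x ≢ y → (S ⊕ x ⊕ y) y ≡ not (S y)
  ⊕₂-at₂ x≢y = trans (⊕-at (S ⊕ x) y) (cong not (⊕-off S (x≢y ∘ sym)))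

  ⊕₂-remove : S x ≡ true → S y ≡ true → x ≢ y →
              ∀ {v} → (S ⊕ x ⊕ y) v ≡ true → v ≢ x × v ≢ y × S v ≡ true
  ⊕₂-remove Sx Sy x≢y {v} Sv = v≢x , v≢y , trans (sym (⊕₂-off v≢x v≢y)) Sv
    where
    v≢x : v ≢ x
    v≢x = separated {S = S ⊕ x ⊕ y} Sv (trans (⊕₂-at₁ x≢y) (cong not Sx))
    v≢y : v ≢ y
    v≢y = separated {S = S ⊕ x ⊕ y} Sv (trans (⊕₂-at₂ x≢y) (cong not Sy))

  ⊕₂-⊆ : ∀ {W} → S ⊆ W → W x ≡ true → W y ≡ true → S ⊕ x ⊕ y ⊆ W
  ⊕₂-⊆ {W} sub Wx Wy {v} Sv = by-cases (v ≟ x) (v ≟ y)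
    where
    by-cases : Dec (v ≡ x) → Dec (v ≡ y) → W v ≡ true
    by-cases (yes refl) _          = Wx
    by-cases (no _)     (yes refl) = Wy
    by-cases (no v≢x)   (no v≢y)   = sub (trans (sym (⊕₂-off v≢x v≢y)) Sv)

module _ (S : Subset n) where

  open Bool.xor-∧-Solver

  ⊕-comm : ∀ x y → S ⊕ x ⊕ y ≗ S ⊕ y ⊕ x
  ⊕-comm x y z = solve 3 (λ s a b → s :+ a :+ b := s :+ b :+ a) refl (S z) (does (z ≟ x)) (does (z ≟ y))

  ⊕-comm₂ : ∀ x y u w → S ⊕ x ⊕ y ⊕ u ⊕ w ≗ S ⊕ u ⊕ w ⊕ x ⊕ y
  ⊕-comm₂ x y u w z = solve 5 (λ s a b c d → s :+ a :+ b :+ c :+ d := s :+ c :+ d :+ a :+ b) refl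
    (S z) (does (z ≟ x)) (does (z ≟ y)) (does (z ≟ u)) (does (z ≟ w))

  ⊕-mid : ∀ u v w x → S ⊕ u ⊕ w ⊕ x ⊕ v ≗ S ⊕ u ⊕ v ⊕ w ⊕ x
  ⊕-mid u v w x z = solve 5 (λ s a b c d → s :+ a :+ c :+ d :+ b := s :+ a :+ b :+ c :+ d) refl
    (S z) (does (z ≟ u)) (does (z ≟ v)) (does (z ≟ w)) (does (z ≟ x))

  ⊕-cancel₂ : ∀ u v w → S ⊕ w ⊕ v ≗ S ⊕ u ⊕ v ⊕ u ⊕ w
  ⊕-cancel₂ u v w z = solve 4 (λ s a b c → s :+ c :+ b := s :+ a :+ b :+ a :+ c) refl
    (S z) (does (z ≟ u)) (does (z ≟ v)) (does (z ≟ w))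

  ⊕-cancel₁ : ∀ u v w → S ⊕ u ⊕ w ≗ S ⊕ u ⊕ v ⊕ w ⊕ v
  ⊕-cancel₁ u v w z = solve 4 (λ s a b c → s :+ a :+ c := s :+ a :+ b :+ c :+ b) refl
    (S z) (does (z ≟ u)) (does (z ≟ v)) (does (z ≟ w))

  ⊕-cancel₃ : ∀ u v w x → S ⊕ w ⊕ x ⊕ x ⊕ v ≗ S ⊕ u ⊕ v ⊕ u ⊕ w
  ⊕-cancel₃ u v w x z = solve 5 (λ s a b c d → s :+ c :+ d :+ d :+ b := s :+ a :+ b :+ a :+ c) refl
    (S z) (does (z ≟ u)) (does (z ≟ v)) (does (z ≟ w)) (does (z ≟ x))

  ⊕-self : ∀ x → S ⊕ x ⊕ x ≗ S
  ⊕-self x z = solve 2 (λ s a → s :+ a :+ a := s) refl (S z) (does (z ≟ x))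

⊕-resp : ∀ {S R : Subset n} x → S ≗ R → S ⊕ x ≗ R ⊕ x
⊕-resp x eq z = cong (_xor does (z ≟ x)) (eq z)

⊆∧#≡⇒≗ : ∀ {S R : Subset n} → S ⊆ R → # S ≡ # R → S ≗ R
⊆∧#≡⇒≗ {n} {S} {R} sub eq x with S x in Sx | R x in Rx
... | true  | true  = refl
... | false | false = refl
... | true  | false = contradiction (trans (sym (sub Sx)) Rx) λ ()
... | false | true  = contradiction eq (<⇒≢ (∑-mono-< (λ _ → ⟦⟧-mono sub) (∈-allFin x) lt))
  where
  lt : ⟦ S x ⟧ < ⟦ R x ⟧
  lt rewrite Sx | Rx = ≤-refl

Unique⇒AllPairs : ∀ {A : Set} {P : A → A → Set} {xs} → (∀ {x y} → x ∈ xs → y ∈ xs → x ≢ y → P x y) →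
                  Unique xs → AllPairs P xs
Unique⇒AllPairs f []       = []
Unique⇒AllPairs f (x# ∷ u) =
  All.tabulate (λ y∈ → f (here refl) (there y∈) (All.lookup x# y∈)) ∷
  Unique⇒AllPairs (λ x∈ y∈ → f (there x∈) (there y∈)) u

module Matching {n : ℕ} (G : Graph n) where

  open Graph G using (adj; irrefl) renaming (sym to adj-sym)

  -- S is the set of endpoints of a matching with k edges.
  data Matchable : ℕ → Subset n → Set where
    none : ∀ {S} → (∀ x → S x ≡ false) → Matchable 0 S
    edge : ∀ {k S} x y → S x ≡ true → S y ≡ true → Adj G x y → Matchable k (S ⊕ x ⊕ y) → Matchable (suc k) S

  adj⇒≢ : ∀ {x y} → Adj G x y → x ≢ y
  adj⇒≢ xy refl = irrefl xy

  resp : ∀ {k S R} → S ≗ R → Matchable k S → Matchable k R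
  resp eq (none ∅)             = none λ x → trans (sym (eq x)) (∅ x)
  resp eq (edge x y Sx Sy xy m) =
    edge x y (trans (sym (eq x)) Sx) (trans (sym (eq y)) Sy) xy (resp (⊕-resp y (⊕-resp x eq)) m)

  matchable? : ∀ k S → Dec (Matchable k S)
  matchable? zero S with all? (λ x → S x ≟ᵇ false)
  ... | yes ∅ = yes (none ∅)
  ... | no ¬∅ = no λ where (none ∅) → ¬∅ ∅
  matchable? (suc k) S
    with any? (λ x → any? (λ y → (S x ≟ᵇ true) ×-dec (S y ≟ᵇ true) ×-dec T? (adj x y) ×-dec matchable? k (S ⊕ x ⊕ y)))
  ... | yes (x , y , Sx , Sy , xy , m) = yes (edge x y Sx Sy xy m)
  ... | no ¬e = no λ where (edge x y Sx Sy xy m) → ¬e (x , y , Sx , Sy , xy , m)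

  size : ∀ {k S} → Matchable k S → # S ≡ 2 * k
  size (none ∅) = trans (∑-cong (allFin n) (cong ⟦_⟧ ∘ ∅)) (#-∅ {n})
  size {suc k} {S} (edge x y Sx Sy xy m) = begin
    # S                       ≡⟨ #-remove S x Sx ⟨
    suc (# (S ⊕ x))           ≡⟨ cong suc (#-remove (S ⊕ x) y (trans (⊕-off S (adj⇒≢ xy ∘ sym)) Sy)) ⟨
    2 + # (S ⊕ x ⊕ y)         ≡⟨ cong (2 +_) (size m) ⟩
    2 + 2 * k                 ≡⟨ *-suc 2 k ⟨
    2 * suc k                 ∎
    where open ≡-Reasoning

  add : ∀ {k S x y} → Matchable k S → S x ≡ false → S y ≡ false → Adj G x y → Matchable (suc k) (S ⊕ x ⊕ y)
  add {S = S} {x} {y} m Sx Sy xy = edge x y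
    (trans (⊕₂-at₁ S (adj⇒≢ xy)) (cong not Sx)) (trans (⊕₂-at₂ S (adj⇒≢ xy)) (cong not Sy)) xy
    (resp (λ z → sym (trans (⊕-comm₂ S x y x y z) (twice z))) m)
    where
    open Bool.xor-∧-Solver
    twice : S ⊕ x ⊕ y ⊕ x ⊕ y ≗ S
    twice z = solve 3 (λ s a b → s :+ a :+ b :+ a :+ b := s) refl (S z) (does (z ≟ x)) (does (z ≟ y))

  -- The edge at `u` may lie deep in the derivation; it is brought to the front and the edges before
  -- it are put back on the remainder.
  remove : ∀ {k S u} → Matchable k S → S u ≡ true →
           ∃ λ w → S w ≡ true × Adj G u w × ∃ λ l → k ≡ suc l × Matchable l (S ⊕ u ⊕ w)
  remove {u = u} (none ∅) Su = contradiction (trans (sym Su) (∅ u)) λ ()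
  remove {S = S} {u} (edge x y Sx Sy xy m) Su with u ≟ x | u ≟ y
  ... | yes refl | _        = y , Sy , xy , _ , refl , m
  ... | no _     | yes refl = x , Sx , adj-sym xy , _ , refl , resp (⊕-comm S x y) m
  ... | no u≢x   | no u≢y with remove m (trans (⊕₂-off S u≢x u≢y) Su)
  ... | w , Sw , uw , l , refl , m′ with ⊕₂-remove S Sx Sy (adj⇒≢ xy) Sw
  ... | w≢x , w≢y , Sw′ = w , Sw′ , uw , _ , refl ,
    edge x y (trans (⊕₂-off S (u≢x ∘ sym) (w≢x ∘ sym)) Sx) (trans (⊕₂-off S (u≢y ∘ sym) (w≢y ∘ sym)) Sy) xy
      (resp (⊕-comm₂ S x y u w) m′)

  -- The two outcomes are the two kinds of alternating path that start at u with an edge of the matching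
  -- of S; v is the other end.
  exchange : ∀ {k l S R u} → Matchable k S → Matchable l R → S u ≡ true → R u ≡ false →
             (∃ λ v → v ≢ u × S v ≡ true × R v ≡ false × Matchable (suc l) (R ⊕ u ⊕ v)) ⊎
             (∃ λ v → R v ≡ true × S v ≡ false × Matchable k (S ⊕ u ⊕ v) × Matchable l (R ⊕ u ⊕ v))
  exchange {zero} {u = u} (none ∅) _ Su _ = contradiction (trans (sym Su) (∅ u)) λ ()
  exchange {suc k} {S = S} {R} {u} mS mR Su Ru with remove mS Su
  ... | w , Sw , uw , _ , refl , mS′ with R w in Rw
  -- The path is the single edge from `u` to `w`, which augments the matching of `R`.
  ... | false = inj₁ (w , adj⇒≢ uw ∘ sym , Sw , Rw , add mR Ru Rw uw)
  ... | true with remove mR Rw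
  ... | z , Rz , wz , _ , refl , mR′ with S z in Sz
  -- The path `u`, `w`, `z` leaves `S` at `z`. Swapping its two edges trades `u` for `z` in `S` and
  -- `z` for `u` in `R`.
  ... | false = inj₂ (z , Rz , Sz
      , edge w z (trans (⊕₂-off S (adj⇒≢ uw ∘ sym) (adj⇒≢ wz)) Sw) (trans (⊕₂-at₂ S u≢z) (cong not Sz)) wz
          (resp (⊕-cancel₁ S u z w) mS′)
      , edge u w (trans (⊕₂-at₁ R u≢z) (cong not Ru)) (trans (⊕₂-off R (adj⇒≢ uw ∘ sym) (adj⇒≢ wz)) Rw) uw
          (resp (⊕-cancel₂ R u z w) mR′))
    where
    u≢z : u ≢ z
    u≢z = separated {S = S} Su Sz
  -- The path goes on from `z`, once the edge `u w` is taken out of the one matching and `w z` out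
  -- of the other.
  ... | true with exchange mS′ mR′ (trans (⊕₂-off S z≢u (adj⇒≢ wz ∘ sym)) Sz) (trans (⊕₂-at₂ R (adj⇒≢ wz)) (cong not Rz))
    where
    z≢u : z ≢ u
    z≢u = separated {S = R} Rz Ru
  ... | inj₁ (v , v≢z , S′v , R′v , m) =
    let v≢u , v≢w , Sv = ⊕₂-remove S Su Sw (adj⇒≢ uw) S′v
        Rv = trans (sym (⊕₂-off R v≢w v≢z)) R′v in
    inj₁ (v , v≢u , Sv , Rv ,
      edge u w (trans (⊕₂-at₁ R (v≢u ∘ sym)) (cong not Ru)) (trans (⊕₂-off R (adj⇒≢ uw ∘ sym) (v≢w ∘ sym)) Rw) uw
        (resp (⊕-cancel₃ R u v w z) m))
  ... | inj₂ (v , R′v , S′v , m , m′) =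
    let v≢w , v≢z , Rv = ⊕₂-remove R Rw Rz (adj⇒≢ wz) R′v
        v≢u = separated {S = R} Rv Ru
        Sv = trans (sym (⊕₂-off S v≢u v≢w)) S′v in
    inj₂ (v , Rv , Sv
      , edge w z (trans (⊕₂-off S (adj⇒≢ uw ∘ sym) (v≢w ∘ sym)) Sw)
                 (trans (⊕₂-off S (separated {S = R} Rz Ru) (v≢z ∘ sym)) Sz) wz
          (resp (⊕-mid S u v w z) m)
      , edge u w (trans (⊕₂-at₁ R (v≢u ∘ sym)) (cong not Ru)) (trans (⊕₂-off R (adj⇒≢ uw ∘ sym) (v≢w ∘ sym)) Rw) uw
          (resp (⊕-cancel₃ R u v w z) m′))

  -- The Gallai-Edmonds argument inside a set of odd size

  module Barriers (K : ℕ) (maximum : ∀ {k S} → Matchable k S → k ≤ K)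
                  (T₀ : Subset n) (size-T₀ : # T₀ ≡ suc (2 * K)) where

    -- As `T₀` has 2K + 1 vertices, a matching of K edges inside it misses exactly one of them; `D`
    -- consists of the vertices that can be missed.
    D : Subset n
    D x = T₀ x ∧ does (matchable? K (T₀ ⊕ x))

    D⁻ : ∀ {x} → D x ≡ true → T₀ x ≡ true × Matchable K (T₀ ⊕ x)
    D⁻ {x} Dx with T₀ x | matchable? K (T₀ ⊕ x)
    D⁻ Dx | true  | yes m = refl , m
    D⁻ () | true  | no _
    D⁻ () | false | _

    D⁺ : ∀ {x} → T₀ x ≡ true → Matchable K (T₀ ⊕ x) → D x ≡ true
    D⁺ {x} Tx m rewrite Tx = dec-true (matchable? K (T₀ ⊕ x)) m

    -- W arises from T₀ by removing b vertices, each of which is missed by no largest matching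
    -- inside the set that it is removed from.
    record IsBarrier (W : Subset n) (b : ℕ) : Set where
      field
        D⊆W       : D ⊆ W
        W⊆T₀      : W ⊆ T₀
        sizes     : # W + b ≡ suc (2 * K)
        bound     : ∀ {k S} → S ⊆ W → Matchable k S → k + b ≤ K
        deficient : ∀ {k S} → S ⊆ W → Matchable k S → k + b ≡ K →
                    ∀ {y} → W y ≡ true → S y ≡ false → D y ≡ true
        missing   : ∀ {x} → D x ≡ true →
                    ∃ λ k → ∃ λ R → R ⊆ W × R x ≡ false × k + b ≡ K × Matchable k R

      exceeds : ∀ {k S} → S ⊆ W → Matchable (suc k) S → k + b ≢ K
      exceeds sub m eq = <-irrefl eq (bound sub m)

      covers : ∀ {k S} → S ⊆ W → Matchable k S → k + b ≡ K → ∀ {a} → W a ≡ true → D a ≡ false → S a ≡ true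
      covers {S = S} sub m eq {a} Wa Da with S a in Sa
      ... | true  = refl
      ... | false = contradiction (trans (sym (deficient sub m eq Wa Sa)) Da) λ ()

    open IsBarrier

    start : IsBarrier T₀ 0
    start .D⊆W = proj₁ ∘ D⁻
    start .W⊆T₀ = id
    start .sizes = trans (+-identityʳ _) size-T₀
    start .bound {k} sub m = ≤-trans (≤-reflexive (+-identityʳ k)) (maximum m)
    start .missing {x} Dx = let Tx , m = D⁻ Dx in
      K , T₀ ⊕ x , ⊕-remove-⊆ {S = T₀} Tx , ⊕-remove-at {S = T₀} Tx , +-identityʳ K , m
    start .deficient {k} {S} sub m eq {y} Ty Sy = D⁺ Ty (resp S≗ (subst (λ j → Matchable j S) (trans (sym (+-identityʳ k)) eq) m))
      where
      #≡ : # S ≡ # (T₀ ⊕ y)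
      #≡ = suc-injective (begin
        suc (# S)           ≡⟨ cong suc (size m) ⟩
        suc (2 * k)         ≡⟨ cong (λ j → suc (2 * j)) (trans (sym (+-identityʳ k)) eq) ⟩
        suc (2 * K)         ≡⟨ size-T₀ ⟨
        # T₀                ≡⟨ #-remove T₀ y Ty ⟨
        suc (# (T₀ ⊕ y))    ∎)
        where open ≡-Reasoning
      S≗ : S ≗ T₀ ⊕ y
      S≗ = ⊆∧#≡⇒≗ (λ {v} Sv → trans (⊕-off T₀ (separated {S = S} Sv Sy)) (sub Sv)) #≡

    module _ {W b} (B : IsBarrier W b) {a x} (Wa : W a ≡ true) (Da : D a ≡ false)
             (Dx : D x ≡ true) (xa : Adj G x a) where

      private
        W∖a : W ⊕ a ⊆ W
        W∖a = ⊕-remove-⊆ {S = W} Wa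
        ≢a : ∀ {y} → (W ⊕ a) y ≡ true → y ≢ a
        ≢a Wy = separated {S = W ⊕ a} Wy (⊕-remove-at {S = W} Wa)
        ∌a : ∀ {S} → S ⊆ W ⊕ a → S a ≡ false
        ∌a {S} sub = ⊈⇒∉ {S = S} {W ⊕ a} sub {a} (⊕-remove-at {S = W} Wa)

      -- If `S` misses `x`, the edge `x a` makes it a largest matching inside `W` that still misses
      -- `y`, unless `y` is `x`. If `S` covers `x`, an alternating path against a largest matching
      -- that misses `x` is switched first; its end `v` decides the case.
      step-deficient : ∀ {k S} → S ⊆ W ⊕ a → Matchable k S → k + suc b ≡ K →
                       ∀ {y} → (W ⊕ a) y ≡ true → S y ≡ false → D y ≡ true
      step-deficient {k} {S} sub m eq {y} W′y Sy with S x in Sx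
      step-deficient {k} {S} sub m eq {y} W′y Sy | false with y ≟ x
      ... | yes refl = Dx
      ... | no y≢x   = B .deficient (⊕₂-⊆ S (W∖a ∘ sub) (B .D⊆W Dx) Wa) (add m Sx (∌a sub) xa)
                         (trans (sym (+-suc k b)) eq) (W∖a W′y) (trans (⊕₂-off S y≢x (≢a W′y)) Sy)
      step-deficient {k} {S} sub m eq {y} W′y Sy | true with B .missing Dx
      ... | j , R , R⊆W , Rx , eqR , mR with exchange m mR Sx Rx
      ... | inj₁ (v , v≢x , Sv , Rv , m′) =
        contradiction eqR (exceeds B (⊕₂-⊆ R R⊆W (B .D⊆W Dx) (W∖a (sub Sv))) m′)
      ... | inj₂ (v , Rv , Sv , mS′ , mR′) with v ≟ a
      -- With the path ending at `a`, the switched `R` would be a largest matching inside `W` that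
      -- misses `a`, although `a` is not in `D`.
      ...   | yes refl = contradiction
                (trans (sym (covers B (⊕₂-⊆ R R⊆W (B .D⊆W Dx) Wa) mR′ eqR Wa Da)) (trans (⊕₂-at₂ R x≢v) (cong not Rv))) λ ()
              where
              x≢v : x ≢ v
              x≢v = separated {S = S} Sx Sv
      ...   | no v≢a with y ≟ v
      -- With the path ending at `y`, the switched `R` itself misses `y`.
      ...     | yes refl = B .deficient (⊕₂-⊆ R R⊆W (B .D⊆W Dx) (W∖a W′y)) mR′ eqR (W∖a W′y)
                             (trans (⊕₂-at₂ R (separated {S = S} Sx Sv)) (cong not Rv))
      -- The switched `S` misses `x`, `a` and `y`, so the edge `x a` can be added as before.
      ...     | no y≢v   = B .deficient (⊕₂-⊆ (S ⊕ x ⊕ v) S′⊆W (B .D⊆W Dx) Wa) (add mS′ S′x S′a xa)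
                             (trans (sym (+-suc k b)) eq) (W∖a W′y)
                             (trans (⊕₂-off (S ⊕ x ⊕ v) y≢x (≢a W′y)) (trans (⊕₂-off S y≢x y≢v) Sy))
                where
                y≢x : y ≢ x
                y≢x = separated {S = S} Sx Sy ∘ sym
                S′⊆W : S ⊕ x ⊕ v ⊆ W
                S′⊆W = ⊕₂-⊆ S (W∖a ∘ sub) (B .D⊆W Dx) (R⊆W Rv)
                S′x : (S ⊕ x ⊕ v) x ≡ false
                S′x = trans (⊕₂-at₁ S (separated {S = S} Sx Sv)) (cong not Sx)
                S′a : (S ⊕ x ⊕ v) a ≡ false
                S′a = trans (⊕₂-off S (adj⇒≢ xa ∘ sym) (v≢a ∘ sym)) (∌a sub)

      -- The stability lemma of Gallai-Edmonds theory: the deletion of a neighbour of `D` outside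
      -- `D` lowers the largest size by one and keeps `D` as it is.
      step : IsBarrier (W ⊕ a) (suc b)
      step .D⊆W {y} Dy = trans (⊕-off W (separated {S = D} Dy Da)) (B .D⊆W Dy)
      step .W⊆T₀ = B .W⊆T₀ ∘ W∖a
      step .sizes = trans (+-suc _ b) (trans (cong (_+ b) (#-remove W a Wa)) (B .sizes))
      step .bound {k} {S} sub m = subst (_≤ K) (sym (+-suc k b)) (≤∧≢⇒< (B .bound (W∖a ∘ sub) m) λ eq →
        contradiction (trans (sym (covers B (W∖a ∘ sub) m eq Wa Da)) (∌a sub)) λ ())
      step .deficient = step-deficient
      step .missing {x′} Dx′ with B .missing Dx′
      -- A largest matching that misses `x′` covers `a`; without its edge at `a` it is largest
      -- inside `W ⊕ a`.
      ... | k , R , R⊆W , Rx′ , eq , m with remove m (covers B R⊆W m eq Wa Da)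
      ... | z , Rz , az , j , refl , m′ = j , R ⊕ a ⊕ z , sub , ⊈⇒∉ {S = R ⊕ a ⊕ z} {R} R′⊆R {x′} Rx′ , trans (+-suc j b) eq , m′
        where
        Ra : R a ≡ true
        Ra = covers B R⊆W m eq Wa Da
        R′⊆R : R ⊕ a ⊕ z ⊆ R
        R′⊆R R′y = proj₂ (proj₂ (⊕₂-remove R Ra Rz (adj⇒≢ az) R′y))
        sub : R ⊕ a ⊕ z ⊆ W ⊕ a
        sub R′y = let y≢a , _ , Ry = ⊕₂-remove R Ra Rz (adj⇒≢ az) R′y in trans (⊕-off W y≢a) (R⊆W Ry)

    ∂D : Subset n
    ∂D a = not (D a) ∧ does (any? (λ x → (D x ≟ᵇ true) ×-dec T? (adj x a)))

    ∂D⁻ : ∀ {a} → ∂D a ≡ true → D a ≡ false × ∃ λ x → D x ≡ true × Adj G x a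
    ∂D⁻ {a} Aa with D a | any? (λ x → (D x ≟ᵇ true) ×-dec T? (adj x a))
    ∂D⁻ Aa | false | yes p = refl , p
    ∂D⁻ () | false | no _
    ∂D⁻ () | true  | _

    neighbour : ∀ {x y} → D x ≡ true → Adj G x y → D y ≡ true ⊎ ∂D y ≡ true
    neighbour {x} {y} Dx xy with D y
    ... | true  = inj₁ refl
    ... | false = inj₂ (dec-true (any? (λ x → (D x ≟ᵇ true) ×-dec T? (adj x y))) (x , Dx , xy))

    -- Otherwise the edge `x y` would extend the matching of `T₀ ⊕ x` to K + 1 edges.
    neighbour∈T₀ : ∀ {x y} → D x ≡ true → Adj G x y → T₀ y ≡ true
    neighbour∈T₀ {x} {y} Dx xy with T₀ y in Ty
    ... | true  = refl
    ... | false = let Tx , m = D⁻ Dx in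
      contradiction (maximum (add m (⊕-remove-at {S = T₀} Tx) (trans (⊕-off T₀ (adj⇒≢ xy ∘ sym)) Ty) xy)) (<⇒≱ ≤-refl)

    remove-all : ∀ L → ∃ λ W → ∃ λ b → IsBarrier W b × (∀ {a} → a ∈ L → ∂D a ≡ true → W a ≡ false)
    remove-all []      = T₀ , 0 , start , λ ()
    remove-all (a ∷ L) with remove-all L
    ... | W , b , B , gone with ∂D a in Aa | W a in Wa
    ... | false | _     = W , b , B , λ where
      (here refl) Aa′ → contradiction (trans (sym Aa) Aa′) λ ()
      (there a∈)      → gone a∈
    ... | true  | false = W , b , B , λ where
      (here refl) _ → Wa
      (there a∈)    → gone a∈
    ... | true  | true  = let Da , x , Dx , xa = ∂D⁻ Aa in W ⊕ a , suc b , step B Wa Da Dx xa , λ where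
      (here refl) _   → ⊕-remove-at {S = W} Wa
      (there a∈)  Aa′ → ⊈⇒∉ {S = W ⊕ a} {W} (⊕-remove-⊆ {S = W} Wa) {_} (gone a∈ Aa′)

    private
      removed = remove-all (allFin n)
      W = proj₁ removed
      b = proj₁ (proj₂ removed)
      B : IsBarrier W b
      B = proj₁ (proj₂ (proj₂ removed))
      ∂D∩W : ∀ {a} → ∂D a ≡ true → W a ≡ false
      ∂D∩W = proj₂ (proj₂ (proj₂ removed)) (∈-allFin _)

    -- `∂D` lies in `T₀` and is disjoint from `W`, and `T₀` has just `b` vertices more than `W`.
    #∂D≤b : # ∂D ≤ b
    #∂D≤b = +-cancelˡ-≤ (# W) (# ∂D) b (begin
      # W + # ∂D                              ≡⟨ ∑-+ (allFin n) (⟦_⟧ ∘ W) (⟦_⟧ ∘ ∂D) ⟨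
      ∑ (allFin n) (λ v → ⟦ W v ⟧ + ⟦ ∂D v ⟧)  ≤⟨ ∑-mono (allFin n) disjoint ⟩
      # T₀                                   ≡⟨ trans size-T₀ (sym (B .sizes)) ⟩
      # W + b                                ∎)
      where
      open ≤-Reasoning
      disjoint : ∀ v → ⟦ W v ⟧ + ⟦ ∂D v ⟧ ≤ ⟦ T₀ v ⟧
      disjoint v with ∂D v in Av | W v in Wv
      ... | false | false = z≤n
      ... | false | true  rewrite B .W⊆T₀ Wv = ≤-refl
      ... | true  | true  = contradiction (trans (sym Wv) (∂D∩W Av)) λ ()
      ... | true  | false with ∂D⁻ Av
      ... | _ , x , Dx , xv rewrite neighbour∈T₀ Dx xv = ≤-refl

    Together : Fin n → Fin n → Set
    Together x y = ∀ {k S} → S ⊆ W → Matchable k S → k + b ≡ K → S x ≡ false → S y ≢ false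

    -- Gallai's relation.
    _≈_ : Fin n → Fin n → Set
    x ≈ y = x ≡ y ⊎ (D x ≡ true × D y ≡ true × Together x y)

    -- Gallai's lemma. A largest matching that misses `x` and `z` must cover `y`. Switching it along
    -- the path from `y` against one that misses `y` makes it miss `y`; the other end of the path
    -- cannot be both `x` and `z`, so a forbidden pair is missed.
    ≈-trans : ∀ {x y z} → x ≈ y → y ≈ z → x ≈ z
    ≈-trans (inj₁ refl) q = q
    ≈-trans (inj₂ p) (inj₁ refl) = inj₂ p
    ≈-trans {x} {y} {z} (inj₂ (Dx , Dy , xy)) (inj₂ (_ , Dz , yz)) with x ≟ z
    ... | yes x≡z = inj₁ x≡z
    ... | no x≢z  = inj₂ (Dx , Dz , xz)
      where
      xz : Together x z
      xz {S = S} sub m eq Sx Sz with S y in Sy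
      ... | false = xy sub m eq Sx Sy
      ... | true with B .missing Dy
      ... | j , R , R⊆W , Ry , eqR , mR with exchange m mR Sy Ry
      ... | inj₁ (v , _ , Sv , _ , m′) = exceeds B (⊕₂-⊆ R R⊆W (B .D⊆W Dy) (sub Sv)) m′ eqR
      ... | inj₂ (v , Rv , Sv , mS′ , _) = by-cases (x ≟ v)
        where
        S′⊆W : S ⊕ y ⊕ v ⊆ W
        S′⊆W = ⊕₂-⊆ S sub (B .D⊆W Dy) (R⊆W Rv)
        S′y : (S ⊕ y ⊕ v) y ≡ false
        S′y = trans (⊕₂-at₁ S (separated {S = S} Sy Sv)) (cong not Sy)
        y≢ : ∀ {w} → S w ≡ false → w ≢ y
        y≢ Sw = separated {S = S} Sy Sw ∘ sym
        by-cases : Dec (x ≡ v) → _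
        by-cases (no x≢v)   = xy S′⊆W mS′ eq (trans (⊕₂-off S (y≢ Sx) x≢v) Sx) S′y
        by-cases (yes refl) = yz S′⊆W mS′ eq S′y (trans (⊕₂-off S (y≢ Sz) (x≢z ∘ sym)) Sz)

    ≈-isEquivalence : IsEquivalence _≈_
    ≈-isEquivalence = record
      { refl  = inj₁ refl
      ; sym   = λ where
          (inj₁ p)              → inj₁ (sym p)
          (inj₂ (Dx , Dy , xy)) → inj₂ (Dy , Dx , λ sub m eq Sy Sx → xy sub m eq Sx Sy)
      ; trans = ≈-trans
      }

    -- An edge between two missed vertices would enlarge a largest matching. Hence each component of
    -- G[D] lies within one class.
    adjacent⇒≈ : ∀ {x y} → D x ≡ true → D y ≡ true → Adj G x y → x ≈ y
    adjacent⇒≈ Dx Dy xy = inj₂ (Dx , Dy , λ {k} {S} sub m eq Sx Sy →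
      exceeds B (⊕₂-⊆ S sub (B .D⊆W Dx) (B .D⊆W Dy)) (add m Sx Sy xy) eq)

    -- `Q` is what one largest matching `R` inside `W` misses: its vertices are in `D` by
    -- `deficient` and pairwise inequivalent because they are missed together. There are (2K + 1 -
    -- b) - 2(K - b) = b + 1 of them.
    inequivalent : ∀ {v₀} → D v₀ ≡ true →
                   ∃ λ Q → (∀ {q} → q ∈ Q → D q ≡ true) × AllPairs (λ x y → ¬ (x ≈ y)) Q × # ∂D < length Q
    inequivalent Dv₀ with B .missing Dv₀
    ... | k , R , R⊆W , _ , eq , m = Q , Q⊆D , Q# , (begin
      suc (# ∂D)    ≤⟨ s≤s #∂D≤b ⟩
      suc b        ≡⟨ +-cancelˡ-≡ (# R) _ _ counted ⟩
      # W∖R        ≡⟨ length-filter-true W∖R (allFin n) ⟨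
      length Q     ∎)
      where
      open ≤-Reasoning
      W∖R : Subset n
      W∖R v = W v ∧ not (R v)
      W∖R? = λ v → W∖R v ≟ᵇ true
      Q = filter W∖R? (allFin n)
      W∖R⁻ : ∀ {v} → W∖R v ≡ true → W v ≡ true × R v ≡ false
      W∖R⁻ {v} eq = ∧-conicalˡ (W v) _ eq , not-injective (∧-conicalʳ (W v) _ eq)
      Q⁻ : ∀ {q} → q ∈ Q → W q ≡ true × R q ≡ false
      Q⁻ q∈ = W∖R⁻ (proj₂ (∈-filter⁻ W∖R? {xs = allFin n} q∈))
      Q⊆D : ∀ {q} → q ∈ Q → D q ≡ true
      Q⊆D q∈ = let Wq , Rq = Q⁻ q∈ in B .deficient R⊆W m eq Wq Rq
      Q# : AllPairs (λ x y → ¬ (x ≈ y)) Q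
      Q# = Unique⇒AllPairs (λ where
        x∈ y∈ x≢y (inj₁ x≡y)         → x≢y x≡y
        x∈ y∈ x≢y (inj₂ (_ , _ , t)) → t R⊆W m eq (proj₂ (Q⁻ x∈)) (proj₂ (Q⁻ y∈)))
        (Unique.filter⁺ W∖R? (Unique.allFin⁺ n))
      split : ∀ v → ⟦ W v ⟧ ≡ ⟦ R v ⟧ + ⟦ W∖R v ⟧
      split v with R v in Rv
      ... | true  rewrite R⊆W Rv = refl
      ... | false with W v
      ... | true  = refl
      ... | false = refl
      counted : # R + suc b ≡ # R + # W∖R
      counted = +-cancelʳ-≡ b _ _ (begin-equality
        # R + suc b + b          ≡⟨ cong (λ r → r + suc b + b) (size m) ⟩
        2 * k + suc b + b        ≡⟨ solve 2 (λ k b → con 2 :* k :+ (con 1 :+ b) :+ b := con 1 :+ con 2 :* (k :+ b)) refl k b ⟩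
        suc (2 * (k + b))        ≡⟨ cong (λ j → suc (2 * j)) eq ⟩
        suc (2 * K)              ≡⟨ B .sizes ⟨
        # W + b                  ≡⟨ cong (_+ b) (trans (∑-cong (allFin n) split) (∑-+ (allFin n) (⟦_⟧ ∘ R) (⟦_⟧ ∘ W∖R))) ⟩
        # R + # W∖R + b          ∎)
        where open +-*-Solver using (solve; _:+_; _:*_; _:=_; con)

-- Matchings as graphs

module _ {n : ℕ} (M : Graph n) where

  private
    edge? = λ (e : Fin n × Fin n) → (proj₁ e <? proj₂ e) ×-dec T? (Graph.adj M (proj₁ e) (proj₂ e))

  ∈-edges⁺ : ∀ {u v} → u <ᶠ v → Adj M u v → (u , v) ∈ edges M
  ∈-edges⁺ {u} {v} u<v uv = ∈-filter⁺ edge? (∈-cartesianProduct⁺ (∈-allFin u) (∈-allFin v)) (u<v , uv)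

  ∈-edges⁻ : ∀ {u v} → (u , v) ∈ edges M → u <ᶠ v × Adj M u v
  ∈-edges⁻ e∈ = proj₂ (∈-filter⁻ edge? {xs = cartesianProduct (allFin n) (allFin n)} e∈)

  edges-unique : Unique (edges M)
  edges-unique = Unique.filter⁺ edge? (Unique.cartesianProduct⁺ (Unique.allFin⁺ n) (Unique.allFin⁺ n))

module _ {n : ℕ} where

  Joins : Graph n → Fin n → Fin n → Fin n → Fin n → Set
  Joins M x y u v = Adj M u v ⊎ ((u ≡ x × v ≡ y) ⊎ (u ≡ y × v ≡ x))

  joins? : ∀ M x y u v → Dec (Joins M x y u v)
  joins? M x y u v = T? (Graph.adj M u v) ⊎-dec (((u ≟ x) ×-dec (v ≟ y)) ⊎-dec ((u ≟ y) ×-dec (v ≟ x)))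

  join : (M : Graph n) (x y : Fin n) → x ≢ y → Graph n
  join M x y x≢y = record
    { adj    = λ u v → isYes (joins? M x y u v)
    ; sym    = λ {u} {v} → fromWitness {a? = joins? M x y v u} ∘ flipped ∘ toWitness {a? = joins? M x y u v}
    ; irrefl = λ {v} → loop ∘ toWitness {a? = joins? M x y v v}
    }
    where
    flipped : ∀ {u v} → Joins M x y u v → Joins M x y v u
    flipped (inj₁ uv)              = inj₁ (Graph.sym M uv)
    flipped (inj₂ (inj₁ (p , q)))  = inj₂ (inj₂ (q , p))
    flipped (inj₂ (inj₂ (p , q)))  = inj₂ (inj₁ (q , p))
    loop : ∀ {v} → ¬ Joins M x y v v
    loop (inj₁ vv)                   = Graph.irrefl M vv
    loop (inj₂ (inj₁ (refl , v≡y)))  = x≢y v≡y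
    loop (inj₂ (inj₂ (v≡y , refl)))  = x≢y v≡y

  module _ (M : Graph n) {x y : Fin n} (x≢y : x ≢ y) where

    join⁺ : ∀ {u v} → Joins M x y u v → Adj (join M x y x≢y) u v
    join⁺ {u} {v} = fromWitness {a? = joins? M x y u v}

    join⁻ : ∀ {u v} → Adj (join M x y x≢y) u v → Joins M x y u v
    join⁻ {u} {v} = toWitness {a? = joins? M x y u v}

    edges-join : Unmatched M x → length (edges M) < length (edges (join M x y x≢y))
    edges-join ¬Mx with <-cmp x y
    ... | tri≈ _ x≡y _ = contradiction x≡y x≢y
    ... | tri< x<y _ _ = length-mono-⊆ (All.tabulate fresh ∷ edges-unique M) λ where
          (here refl) → ∈-edges⁺ (join M x y x≢y) x<y (join⁺ (inj₂ (inj₁ (refl , refl))))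
          (there e∈)  → let lt , uv = ∈-edges⁻ M e∈ in ∈-edges⁺ (join M x y x≢y) lt (join⁺ (inj₁ uv))
      where
      fresh : ∀ {e} → e ∈ edges M → (x , y) ≢ e
      fresh e∈ refl = ¬Mx y (proj₂ (∈-edges⁻ M e∈))
    ... | tri> _ _ y<x = length-mono-⊆ (All.tabulate fresh ∷ edges-unique M) λ where
          (here refl) → ∈-edges⁺ (join M x y x≢y) y<x (join⁺ (inj₂ (inj₂ (refl , refl))))
          (there e∈)  → let lt , uv = ∈-edges⁻ M e∈ in ∈-edges⁺ (join M x y x≢y) lt (join⁺ (inj₁ uv))
      where
      fresh : ∀ {e} → e ∈ edges M → (y , x) ≢ e
      fresh e∈ refl = ¬Mx y (Graph.sym M (proj₂ (∈-edges⁻ M e∈)))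

module Realisation {n : ℕ} (G : Graph n) where

  open Matching G

  -- For the number of edges a lower bound is enough: maximality compares other matchings with `k`.
  realise : ∀ {k S} → Matchable k S → ∃ λ M → IsMatching G M × (∀ {u v} → Adj M u v → S u ≡ true) ×
            (∀ {u} → S u ≡ true → ∃ (Adj M u)) × k ≤ length (edges M)
  realise (none ∅) = record { adj = λ _ _ → false ; sym = λ () ; irrefl = λ () } ,
    ((λ ()) , λ ()) , (λ ()) , (λ {u} Su → contradiction (trans (sym Su) (∅ u)) λ ()) , z≤n
  realise {S = S} (edge x y Sx Sy xy m) with realise m
  ... | M , (M⊆G , functional) , covered , covers , k≤ =
    M⁺ , ((λ uv → ⊆G (join⁻ M x≢y uv)) , (λ uv uw → fun (join⁻ M x≢y uv) (join⁻ M x≢y uw))) ,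
    (λ uv → cov (join⁻ M x≢y uv)) , (λ {u} Su → cvs u Su (u ≟ x) (u ≟ y)) ,
    ≤-trans (s≤s k≤) (edges-join M x≢y λ w xw → proj₁ (in-S xw) refl)
    where
    x≢y = adj⇒≢ xy
    M⁺ = join M x y x≢y
    in-S : ∀ {u v} → Adj M u v → u ≢ x × u ≢ y × S u ≡ true
    in-S uv = ⊕₂-remove S Sx Sy x≢y (covered uv)
    ⊆G : ∀ {u v} → Joins M x y u v → Adj G u v
    ⊆G (inj₁ uv)                   = M⊆G uv
    ⊆G (inj₂ (inj₁ (refl , refl))) = xy
    ⊆G (inj₂ (inj₂ (refl , refl))) = Graph.sym G xy
    fun : ∀ {u v w} → Joins M x y u v → Joins M x y u w → v ≡ w
    fun (inj₁ uv)                   (inj₁ uw)                   = functional uv uw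
    fun (inj₁ uv)                   (inj₂ (inj₁ (refl , _)))    = contradiction refl (proj₁ (in-S uv))
    fun (inj₁ uv)                   (inj₂ (inj₂ (refl , _)))    = contradiction refl (proj₁ (proj₂ (in-S uv)))
    fun (inj₂ (inj₁ (refl , _)))    (inj₁ uw)                   = contradiction refl (proj₁ (in-S uw))
    fun (inj₂ (inj₂ (refl , _)))    (inj₁ uw)                   = contradiction refl (proj₁ (proj₂ (in-S uw)))
    fun (inj₂ (inj₁ (refl , refl))) (inj₂ (inj₁ (_ , refl)))    = refl
    fun (inj₂ (inj₁ (refl , _)))    (inj₂ (inj₂ (x≡y , _)))     = contradiction x≡y x≢y
    fun (inj₂ (inj₂ (refl , _)))    (inj₂ (inj₁ (y≡x , _)))     = contradiction (sym y≡x) x≢y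
    fun (inj₂ (inj₂ (refl , refl))) (inj₂ (inj₂ (_ , refl)))    = refl
    cov : ∀ {u v} → Joins M x y u v → S u ≡ true
    cov (inj₁ uv)                = proj₂ (proj₂ (in-S uv))
    cov (inj₂ (inj₁ (refl , _))) = Sx
    cov (inj₂ (inj₂ (refl , _))) = Sy
    cvs : ∀ u → S u ≡ true → Dec (u ≡ x) → Dec (u ≡ y) → ∃ (Adj M⁺ u)
    cvs u Su (yes u≡x) _         = y , join⁺ M x≢y (inj₂ (inj₁ (u≡x , refl)))
    cvs u Su (no _)    (yes u≡y) = x , join⁺ M x≢y (inj₂ (inj₂ (u≡y , refl)))
    cvs u Su (no u≢x)  (no u≢y)  = let v , uv = covers (trans (⊕₂-off S u≢x u≢y) Su) in v , join⁺ M x≢y (inj₁ uv)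

  -- The listed edges are added one at a time; an end that was already covered would have two
  -- partners or its edge would be listed twice.
  matchable-edges : ∀ M → IsMatching G M → ∃ λ S → Matchable (length (edges M)) S
  matchable-edges M (M⊆G , functional) =
    let S , m , _ = cover (edges M) (edges-unique M) (∈-edges⁻ M) in S , m
    where
    cover : ∀ L → Unique L → (∀ {u v} → (u , v) ∈ L → u <ᶠ v × Adj M u v) →
            ∃ λ S → Matchable (length L) S ×
                    (∀ {z} → S z ≡ true → ∃ λ u → ∃ λ v → (u , v) ∈ L × (z ≡ u ⊎ z ≡ v))
    cover [] _ _ = (λ _ → false) , none (λ _ → refl) , λ ()
    cover ((u , v) ∷ L) (uv# ∷ L#) edge⁻ with cover L L# (edge⁻ ∘ there) | edge⁻ (here refl)
    ... | S , m , ends | u<v , uv = S ⊕ u ⊕ v , add m u∉S v∉S (M⊆G uv) , λ {z} Sz → ends′ Sz (z ≟ u) (z ≟ v)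
      where
      u∉S : S u ≡ false
      u∉S with S u in Su
      ... | false = refl
      ... | true with ends Su
      ... | u′ , v′ , e∈ , inj₁ refl = contradiction
        (cong (u ,_) (functional uv (proj₂ (edge⁻ (there e∈))))) (All.lookup uv# e∈)
      -- The earlier edge would be the same one with its ends exchanged, but every edge is listed
      -- with its smaller end first.
      ... | u′ , v′ , e∈ , inj₂ refl with functional uv (Graph.sym M (proj₂ (edge⁻ (there e∈))))
      ... | refl = contradiction (proj₁ (edge⁻ (there e∈))) (<ᶠ-asym u<v)
      v∉S : S v ≡ false
      v∉S with S v in Sv
      ... | false = refl
      ... | true with ends Sv
      ... | u′ , v′ , e∈ , inj₂ refl = contradiction
        (cong (_, v) (functional (Graph.sym M uv) (Graph.sym M (proj₂ (edge⁻ (there e∈)))))) (All.lookup uv# e∈)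
      ... | u′ , v′ , e∈ , inj₁ refl with functional (Graph.sym M uv) (proj₂ (edge⁻ (there e∈)))
      ... | refl = contradiction (proj₁ (edge⁻ (there e∈))) (<ᶠ-asym u<v)
      ends′ : ∀ {z} → (S ⊕ u ⊕ v) z ≡ true → Dec (z ≡ u) → Dec (z ≡ v) → ∃ λ a → ∃ λ b → (a , b) ∈ (u , v) ∷ L × (z ≡ a ⊎ z ≡ b)
      ends′ Sz (yes z≡u) _         = u , v , here refl , inj₁ z≡u
      ends′ Sz (no _)    (yes z≡v) = u , v , here refl , inj₂ z≡v
      ends′ Sz (no z≢u)  (no z≢v)  =
        let a , b , e∈ , p = ends (trans (sym (⊕₂-off S z≢u z≢v)) Sz) in a , b , there e∈ , p

-- The choice of the covered set

greatest : ∀ {P : ℕ → Set} → Decidable P → ∀ N → (∀ {k} → P k → k ≤ N) → ∃ P → ∃ λ k → P k × (∀ {j} → P j → j ≤ k)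
greatest P? zero    bound (k , Pk) with bound Pk
... | z≤n = 0 , Pk , bound
greatest P? (suc N) bound p with P? (suc N)
... | yes PN = suc N , PN , bound
... | no ¬PN = greatest P? N (λ Pk → s≤s⁻¹ (≤∧≢⇒< (bound Pk) λ where refl → ¬PN Pk)) p

module Optimum {n : ℕ} (G : Graph n) (H : Subset n) where

  open Matching G

  weight : Subset n → ℕ
  weight S = # (λ v → S v ∧ H v)

  #≤n : ∀ (S : Subset n) → # S ≤ # {n} (λ _ → true)
  #≤n S = ⊆⇒#≤ {S = S} {λ _ → true} λ _ → refl

  -- Two successive searches: for the largest `K`, and then for the greatest weight at this `K`.
  -- They run over Boolean vectors; other sets enter through `tabulate`, up to pointwise equality.
  optimum : ∃ λ K → ∃ λ S → Matchable K S × (∀ {k R} → Matchable k R → k ≤ K) ×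
            (∀ {R} → Matchable K R → weight R ≤ weight S)
  optimum with greatest (λ k → anySubset? (λ S → matchable? k (lookup S))) (# {n} (λ _ → true))
                 (λ {k} (S , m) → ≤-trans (m≤m+n k _) (≤-trans (≤-reflexive (sym (size m))) (#≤n (lookup S))))
                 (0 , tabulate (λ _ → false) , none (lookup∘tabulate _))
  ... | K , (S₀ , m₀) , K-max
    with greatest (λ j → anySubset? (λ S → matchable? K (lookup S) ×-dec (weight (lookup S) ℕ.≟ j))) (# {n} (λ _ → true))
           (λ where (S , _ , refl) → #≤n _) (weight (lookup S₀) , S₀ , m₀ , refl)
  ... | j , (S , m , refl) , j-max = K , lookup S , m ,
    (λ {k} {R} mR → K-max (tabulate R , resp (λ x → sym (lookup∘tabulate R x)) mR)) ,
    (λ {R} mR → ≤-trans (≤-reflexive (∑-cong (allFin n) λ v → cong (λ b → ⟦ b ∧ H v ⟧) (sym (lookup∘tabulate R v))))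
                  (j-max (tabulate R , resp (λ x → sym (lookup∘tabulate R x)) mR , refl)))

-- The contradiction from planarity

module _ {n : ℕ} (G : Graph n) (planar : Planar G) where

  open Matching G
  open Realisation G

  private
    module S = Sphere G (proj₁ planar) (proj₂ planar)
    open Darts G

    high : Subset n
    high v = does (6 ≤? degree G v)

    high⁻ : ∀ {v} → high v ≡ true → 6 ≤ degree G v
    high⁻ {v} hv = does⁻ (6 ≤? degree G v) hv
      where
      does⁻ : ∀ {P : Set} (P? : Dec P) → does P? ≡ true → P
      does⁻ (yes p) _ = p

    open Optimum G high

  -- The darts inside `D` and those touching `D` together number at least 12|D|. The edge bound
  -- allows 6|D| - 6|Q| of the former and 6|D| + 6|A| of the latter.
  inequivalent≤neighbours : ∀ (D A : Subset n) → D ⊆ high → (∀ {x y} → D x ≡ true → Adj G x y → D y ≡ true ⊎ A y ≡ true) →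
                     ∀ {R : Fin n → Fin n → Set} → IsEquivalence R →
                     (∀ {x y} → D x ≡ true → D y ≡ true → Adj G x y → R x y) →
                     ∀ Q → (∀ {q} → q ∈ Q → D q ≡ true) → AllPairs (λ x y → ¬ R x y) Q → length Q ≤ # A
  inequivalent≤neighbours D A D⊆high neighbour {R} R-equiv joins Q Q⊆D Q# =
    *-cancelˡ-≤ 6 (+-cancelˡ-≤ (6 * # D + 6 * # D) _ _ (begin
      (6 * # D + 6 * # D) + 6 * length Q           ≤⟨ +-monoˡ-≤ _ (+-mono-≤ degrees degrees) ⟩
      (t + t) + 6 * length Q                       ≡⟨ cong (_+ 6 * length Q) inside+touching ⟨
      (count darts inside + count darts touching) + 6 * length Q
                                                   ≡⟨ xy∙z≈xz∙y (count darts inside) _ _ ⟩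
      (count darts inside + 6 * length Q) + count darts touching
                                                   ≤⟨ +-mono-≤ inside≤ touching≤ ⟩
      6 * # D + 6 * (# D + # A)
        ≡⟨ solve 2 (λ d a → con 6 :* d :+ con 6 :* (d :+ a) := (con 6 :* d :+ con 6 :* d) :+ con 6 :* a) refl (# D) (# A) ⟩
      (6 * # D + 6 * # D) + 6 * # A                ∎))
    where
    open ≤-Reasoning
    open +-*-Solver using (solve; _:+_; _:*_; _:=_; con)
    t = count darts (D ∘ tail)
    inside touching : Dart G → Bool
    inside   d = D (tail d) ∧ D (head d)
    touching d = D (tail d) ∨ D (head d)
    degrees : 6 * # D ≤ t
    degrees = begin
      6 * # D                                        ≡⟨ ∑-*ˡ (allFin n) 6 _ ⟨
      ∑ (allFin n) (λ u → 6 * ⟦ D u ⟧)               ≤⟨ ∑-mono (allFin n) le ⟩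
      ∑ (allFin n) (λ u → degree G u * ⟦ D u ⟧)      ≡⟨ count-tails D ⟨
      t                                              ∎
      where
      le : ∀ u → 6 * ⟦ D u ⟧ ≤ degree G u * ⟦ D u ⟧
      le u with D u in Du
      ... | false = z≤n
      ... | true  = *-monoˡ-≤ 1 (high⁻ (D⊆high Du))
    inside+touching : count darts inside + count darts touching ≡ t + t
    inside+touching = begin-equality
      count darts inside + count darts touching                          ≡⟨ ∑-+ darts (⟦_⟧ ∘ inside) (⟦_⟧ ∘ touching) ⟨
      ∑ darts (λ d → ⟦ inside d ⟧ + ⟦ touching d ⟧)                      ≡⟨ ∑-cong darts (λ d → ∧+∨ (D (tail d)) (D (head d))) ⟩
      ∑ darts (λ d → ⟦ D (tail d) ⟧ + ⟦ D (head d) ⟧)                    ≡⟨ ∑-+ darts (⟦_⟧ ∘ D ∘ tail) (⟦_⟧ ∘ D ∘ head) ⟩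
      t + count darts (D ∘ head)                                         ≡⟨ cong (t +_) (∑-reverse (⟦_⟧ ∘ D ∘ tail)) ⟩
      t + t                                                              ∎
      where
      ∧+∨ : ∀ a b → ⟦ a ∧ b ⟧ + ⟦ a ∨ b ⟧ ≡ ⟦ a ⟧ + ⟦ b ⟧
      ∧+∨ true  true  = refl
      ∧+∨ true  false = refl
      ∧+∨ false b     = refl
    inside⁻ : ∀ d → inside d ≡ true → D (tail d) ≡ true × D (head d) ≡ true
    inside⁻ d p = ∧-conicalˡ (D (tail d)) _ p , ∧-conicalʳ (D (tail d)) _ p
    inside≤ : count darts inside + 6 * length Q ≤ 6 * # D
    inside≤ = S.edge-bound inside (λ d → ∧-comm (D (head d)) (D (tail d))) D (λ d → proj₁ ∘ inside⁻ d)
      R-equiv (λ d p → joins (proj₁ (inside⁻ d p)) (proj₂ (inside⁻ d p)) (joined d)) Q Q⊆D Q#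
    D∪A : Subset n
    D∪A v = D v ∨ A v
    tail∈ : ∀ d → touching d ≡ true → D∪A (tail d) ≡ true
    tail∈ d p with D (tail d) in Dt
    ... | true  = refl
    ... | false with neighbour p (joined (reverse d))
    ... | inj₁ Dt′ = contradiction (trans (sym Dt) Dt′) λ ()
    ... | inj₂ At  = At
    touching≤ : count darts touching ≤ 6 * (# D + # A)
    touching≤ = begin
      count darts touching          ≤⟨ m≤m+n _ _ ⟩
      -- The components of this graph are not counted: `Q` is empty and the relation trivial.
      count darts touching + 6 * 0  ≤⟨ S.edge-bound touching (λ d → ∨-comm (D (head d)) (D (tail d))) D∪A tail∈
                                         {R = λ _ _ → ⊤} _ _ [] (λ ()) [] ⟩
      6 * # D∪A
        ≤⟨ *-monoʳ-≤ 6 (≤-trans (∑-mono (allFin n) (λ v → ∨≤+ (D v) (A v))) (≤-reflexive (∑-+ (allFin n) _ _))) ⟩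
      6 * (# D + # A)               ∎
      where
      ∨≤+ : ∀ a b → ⟦ a ∨ b ⟧ ≤ ⟦ a ⟧ + ⟦ b ⟧
      ∨≤+ true  b = s≤s z≤n
      ∨≤+ false b = ≤-refl

  module _ {K S₀} (m₀ : Matchable K S₀) (maximum : ∀ {k R} → Matchable k R → k ≤ K)
           (heaviest : ∀ {R} → Matchable K R → weight R ≤ weight S₀) where

    covers-high : ∀ {v} → high v ≡ true → S₀ v ≡ true
    covers-high {v₀} hv₀ with S₀ v₀ in Sv₀
    ... | true  = refl
    ... | false = contradiction (inequivalent≤neighbours B.D B.∂D D⊆high B.neighbour B.≈-isEquivalence B.adjacent⇒≈ Q Q⊆D Q#) (<⇒≱ #∂D<Q)
      where
      T₀ = S₀ ⊕ v₀
      module B = Barriers K maximum T₀ (trans (#-add S₀ v₀ Sv₀) (cong suc (size m₀)))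
      Tv₀ : T₀ v₀ ≡ true
      Tv₀ = trans (⊕-at S₀ v₀) (cong not Sv₀)
      -- `D` is nonempty: it contains `v₀`, whose removal from `T₀` gives back `S₀`.
      structure = B.inequivalent (B.D⁺ Tv₀ (resp (λ x → sym (⊕-self S₀ v₀ x)) m₀))
      Q    = proj₁ structure
      Q⊆D  = proj₁ (proj₂ structure)
      Q#   = proj₁ (proj₂ (proj₂ structure))
      #∂D<Q = proj₂ (proj₂ (proj₂ structure))
      -- Otherwise T₀ ⊕ x would be heavier than S₀.
      D⊆high : B.D ⊆ high
      D⊆high {x} Dx with high x in hx
      ... | true  = refl
      ... | false = contradiction (heaviest (proj₂ (B.D⁻ Dx))) (<⇒≱ (∑-mono-< le (∈-allFin v₀) lt))
        where
        lt : ⟦ S₀ v₀ ∧ high v₀ ⟧ < ⟦ (T₀ ⊕ x) v₀ ∧ high v₀ ⟧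
        lt = ≤-reflexive (trans (cong (λ b → suc ⟦ b ∧ high v₀ ⟧) Sv₀)
               (sym (cong₂ (λ a b → ⟦ a ∧ b ⟧) (trans (⊕-off T₀ (separated {S = high} hv₀ hx)) Tv₀) hv₀)))
        le : ∀ v → ⟦ S₀ v ∧ high v ⟧ ≤ ⟦ (T₀ ⊕ x) v ∧ high v ⟧
        le v = ⟦⟧-mono λ p →
          let Sv = ∧-conicalˡ (S₀ v) (high v) p
              hv = ∧-conicalʳ (S₀ v) (high v) p
              Tv = trans (⊕-off S₀ (separated {S = S₀} Sv Sv₀)) Sv in
          cong₂ _∧_ (trans (⊕-off T₀ (separated {S = high} hv hx)) Tv) hv

corollary4p2 : (n : ℕ) (G : Graph n) → Planar G →
    Σ (Graph n) λ M → IsMaximumMatching G M × (Perfect M ⊎ ((v : Fin n) → Unmatched M v → degree G v ≤ 5))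
corollary4p2 n G planar with Optimum.optimum G (λ v → does (6 ≤? degree G v))
... | K , S , m , maximum , heaviest with Realisation.realise G m
... | M , matching , _ , covers , K≤ = M ,
  (matching , λ M′ matching′ → ≤-trans (maximum (proj₂ (Realisation.matchable-edges G M′ matching′))) K≤) ,
  -- A vertex of degree at least 6 belongs to `S`, so `M` has an edge at it.
  inj₂ λ v unmatched → s≤s⁻¹ (≰⇒> λ 6≤ →
    let w , vw = covers (covers-high G planar m maximum heaviest (dec-true (6 ≤? degree G v) 6≤)) in unmatched w vw)
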